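{- There is a deterministic algorithm which, given two matroids $\mathcal{M}_1=(V,\mathcal{I}_1)$ and $\mathcal{M}_2=(V,\mathcal{I}_2)$ on the same ground set $V$ with $|V|=n$ (accessed only through independence oracles) and a parameter $\varepsilon>0$, finds a common independent set $S\in\mathcal{I}_1\cap\mathcal{I}_2$ with $|S|\ge(1-\varepsilon)r$, using $O\!\left(\frac{n\sqrt{r\log r}}{\varepsilon}\right)$ independence queries, where $r$ is the maximum cardinality of a set in $\mathcal{I}_1\cap\mathcal{I}_2$.
   Context: A matroid is a pair $\mathcal{M}=(V,\mathcal{I})$ with $V$ a finite ground set and $\mathcal{I}\subseteq 2^V$ a nonempty family of "independent sets" that is downward closed and satisfies the exchange property (if $S,S'\in\mathcal{I}$ and $|S|>|S'|$ then there is $x\in S\setminus S'$ with $S'\cup\{x\}\in\mathcal{I}$). The algorithm accesses the matroids only via independence queries: for a set $S\subseteq V$ and $i\in\{1,2\}$, a query answers whether $S\in\mathcal{I}_i$. Query complexity counts the number of such queries. A common independent set is a set in $\mathcal{I}_1\cap\mathcal{I}_2$; $r$ denotes the size of a largest common independent set. -}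

module Defs where

open import Data.Nat using (ℕ; zero; suc; _+_; _*_; _<_)
open import Data.Nat.Logarithm using (⌈log₂_⌉)
open import Data.Bool using (Bool; true; false)
open import Data.Product using (Σ; _×_; _,_; ∃-syntax)
open import Data.Fin using (Fin)
open import Data.Fin.Subset using (Subset; _⊆_; ∣_∣; ⁅_⁆; _∪_; ⊥; _∈_; _∉_)
open import Data.Integer using (+_)
open import Data.Rational using (ℚ; _/_)
open import Relation.Binary.PropositionalEquality using (_≡_)

Oracle : ℕ → Set
Oracle n = Subset n → Bool

Indep : ∀ {n} → Oracle n → Subset n → Set
Indep I S = I S ≡ true

record IsMatroid {n : ℕ} (I : Oracle n) : Set where
  field
    nonempty   : ∃[ S ] Indep I S
    downClosed : ∀ {S T} → S ⊆ T → Indep I T → Indep I S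
    exchange   : ∀ {S T} → Indep I S → Indep I T → ∣ T ∣ < ∣ S ∣ →
                 ∃[ x ] (x ∈ S × x ∉ T × Indep I (T ∪ ⁅ x ⁆))

CommonIndep : ∀ {n} → Oracle n → Oracle n → Subset n → Set
CommonIndep I₁ I₂ S = Indep I₁ S × Indep I₂ S

IsMaxCommonSize : ∀ {n} → Oracle n → Oracle n → ℕ → Set
IsMaxCommonSize I₁ I₂ r =
  (∃[ S ] (CommonIndep I₁ I₂ S × ∣ S ∣ ≡ r)) ×
  (∀ S → CommonIndep I₁ I₂ S → ∣ S ∣ Data.Nat.≤ r)

-- A deterministic algorithm in the independence-oracle model on ground set
-- Fin n: a (finite) decision tree. A node asks "is S ∈ I₁ ?" (false) or
-- "is S ∈ I₂ ?" (true) and branches on the answer; a leaf outputs a set.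
data QueryTree (n : ℕ) : Set where
  output : Subset n → QueryTree n
  query  : (which : Bool) → (S : Subset n) → (Bool → QueryTree n) → QueryTree n

run : ∀ {n} → Oracle n → Oracle n → QueryTree n → Subset n × ℕ
run I₁ I₂ (output S) = S , 0
run I₁ I₂ (query false S k) with run I₁ I₂ (k (I₁ S))
... | T , q = T , suc q
run I₁ I₂ (query true S k) with run I₁ I₂ (k (I₂ S))
... | T , q = T , suc q

ℕtoℚ : ℕ → ℚ
ℕtoℚ m = (+ m) / 1

{-# OPTIONS --safe #-}
-- Two algorithms are combined.
--
-- An auction with prices in {0, …, K} keeps a common independent set J whose elements hold
-- their price plus one in M₂.  In each round J is rebuilt greedily from high to low prices, where
-- an element must also be M₁-independent over the cheaper ones, and everything that M₂ rejects
-- becomes dearer by one.  Weak matroid intersection duality at each of the K price thresholds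
-- gives K r ≤ (K + 1) |J| + K a, where |J| + a is the M₁-rank of the elements below price K, while
-- a cheapest M₁-basis becomes dearer by a.  Its price is at most K · rank M₁, and M₁ may be truncated to
-- rank ≤ 2 r, after O(K²) rounds of O(n) queries a is so small that K r ≤ (K + 2) |J|.
--
-- If K ≤ √r this is the claimed bound with K ≈ 2/ε.  Otherwise the auction is run with √r prices
-- only, which leaves a deficit O(√r).  It is removed by O(√r) breadth-first searches for augmenting
-- paths, each cut off after K layers and using O(n K) queries; duality between consecutive
-- layers shows K r ≤ (K + 1) |S| if a search fails.  In total this is O(n K √r) queries.
module Submission where

open import Defs
open import Data.Nat using (ℕ; suc; _+_) renaming (_*_ to _*ℕ_)
import Data.Nat as ℕ
import Data.Nat.Properties as ℕₚ
open import Data.Nat.Logarithm using (⌈log₂_⌉)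
open import Data.Product using (Σ; _×_; _,_; ∃-syntax; proj₁; proj₂)
open import Data.Fin.Subset using (∣_∣)
open import Relation.Binary.PropositionalEquality using (_≡_; _≢_; refl; sym; trans; cong; cong₂; subst; subst₂)

-- Rank functions, contractions and circuits are never constructed. Ranks are sizes of explicit
-- independent sets, compared by `spanned-≤`. Independence over the cheaper elements, that is, in a
-- contraction, means independence together with every independent `W` of cheaper elements;
-- `indep-▹` reduces this to the single basis that the algorithm tests.
--
-- The factor K + 1 stems from the gap between the price of an element of J and the price at which
-- it is held: at threshold t the elements priced exactly t are counted in both matroids, and over
-- all t each of them is such a surplus at most once.
--
-- The number of rounds: while K a > |J|, duality bounds r by (K + 2) a, so a round takes at least r
-- / (K + 2) from a potential that starts at no more than 2 K r. About 2 K (K + 2) rounds exhaust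
-- it.
--
-- The switch at √r: an auction with k prices costs O(n k²) queries and leaves O(r / k) elements
-- missing, while each missing element costs one search of O(n K) queries. With k ≈ √r < K both
-- parts are O(n K √r).

module Algorithm where
  open import Data.Nat using (zero; _∸_; _^_; _≤_; _<_; z≤n; s≤s; z<s; _≤?_; _<?_)
  open import Data.Nat.Solver using (module +-*-Solver)
  open import Data.Bool using (Bool; true; false; if_then_else_; not)
  import Data.Bool.Properties as Boolₚ
  open import Data.Maybe using (Maybe; just; nothing)
  open import Data.Sum using (_⊎_; inj₁; inj₂; [_,_]′)
  open import Data.Empty using (⊥-elim) renaming (⊥ to Absurd)
  open import Data.Fin using (Fin; zero; suc)
  import Data.Fin.Properties as Finₚ
  open import Data.Fin.Subset using (Subset; _⊆_; ⁅_⁆; _∪_; ∁; ⊤; ⊥; _∈_; _∉_)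
  open import Data.Fin.Subset.Properties as Subₚ using (_∈?_)
  open import Data.Vec using ([]; _∷_; tabulate; lookup; here; there)
  import Data.Vec.Properties as Vecₚ
  open import Data.List using (List; []; _∷_; length; _++_; map; take; drop)
  import Data.List.Properties as Listₚ
  open import Data.List.Membership.Propositional using () renaming (_∈_ to _∈ₗ_; _∉_ to _∉ₗ_)
  open import Data.List.Membership.Propositional.Properties using (∈-map⁺; ∈-map⁻; ∈-++⁺ˡ; ∈-++⁺ʳ; ∈-++⁻)
  import Data.List.Relation.Unary.Any as Any
  open import Relation.Nullary using (¬_; Dec; yes; no; does; contradiction)
  open import Relation.Nullary.Decidable using (_×-dec_; ¬?; dec-true)

  private variable
    n : ℕ

  -- Finite sets

  infixl 6 _▹_
  _▹_ : Subset n → Fin n → Subset n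
  X ▹ v = X ∪ ⁅ v ⁆

  module _ {X : Subset n} where
    old : ∀ {v u} → u ∈ X → u ∈ X ▹ v
    old = Subₚ.p⊆p∪q _

    new : ∀ {v} → v ∈ X ▹ v
    new {v} = Subₚ.q⊆p∪q X ⁅ v ⁆ (Subₚ.x∈⁅x⁆ v)

    ▹⁻ : ∀ {v u} → u ∈ X ▹ v → u ∈ X ⊎ u ≡ v
    ▹⁻ {v} u∈ with Subₚ.x∈p∪q⁻ X ⁅ v ⁆ u∈
    ... | inj₁ u∈X = inj₁ u∈X
    ... | inj₂ u∈v = inj₂ (Subₚ.x∈⁅y⁆⇒x≡y v u∈v)

    ▹-⊆ : ∀ {v Y} → X ⊆ Y → v ∈ Y → X ▹ v ⊆ Y
    ▹-⊆ X⊆Y v∈Y u∈ with ▹⁻ u∈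
    ... | inj₁ u∈X = X⊆Y u∈X
    ... | inj₂ refl = v∈Y

  ▹-mono : ∀ {X Y : Subset n} {v} → X ⊆ Y → X ▹ v ⊆ Y ▹ v
  ▹-mono X⊆Y = ▹-⊆ (λ u∈ → old (X⊆Y u∈)) new

  ∪-monoʳ : ∀ {C X Y : Subset n} → X ⊆ Y → C ∪ X ⊆ C ∪ Y
  ∪-monoʳ {C = C} {X} X⊆Y v∈ = Subₚ.x∈p∪q⁺ ([ inj₁ , (λ v∈X → inj₂ (X⊆Y v∈X)) ]′ (Subₚ.x∈p∪q⁻ C X v∈))

  ∪-⊥ˡ : ∀ {C X : Subset n} → (∀ {v} → v ∉ X) → C ∪ X ⊆ C
  ∪-⊥ˡ {C = C} {X} none v∈ = [ (λ v∈C → v∈C) , (λ v∈X → contradiction v∈X none) ]′ (Subₚ.x∈p∪q⁻ C X v∈)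

  abstract
    select : {P : Fin n → Set} → (∀ v → Dec (P v)) → Subset n
    select P? = tabulate (λ v → does (P? v))

    lookup-select : {P : Fin n → Set} (P? : ∀ v → Dec (P v)) → ∀ v → lookup (select P?) v ≡ does (P? v)
    lookup-select P? v = Vecₚ.lookup∘tabulate _ v

  module _ {P : Fin n → Set} (P? : ∀ v → Dec (P v)) where
    ∈-select⁺ : ∀ {v} → P v → v ∈ select P?
    ∈-select⁺ {v} Pv = Vecₚ.lookup⇒[]= v _ (trans (lookup-select P? v) (dec-true (P? v) Pv))

    ∈-select⁻ : ∀ {v} → v ∈ select P? → P v
    ∈-select⁻ {v} v∈ with P? v | trans (sym (Vecₚ.[]=⇒lookup v∈)) (lookup-select P? v)
    ... | yes Pv | _ = Pv

  -- The programs branch on `does`, which forgets the evidence; the motive `Z` hands it back to the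
  -- correctness proof of each branch.
  if-elim : ∀ {a} {A : Set a} {ℓ} (Z : A → Set ℓ) {P : Set} (d : Dec P) {x y : A} →
            (P → Z x) → (¬ P → Z y) → Z (if does d then x else y)
  if-elim Z (yes p) f g = f p
  if-elim Z (no ¬p) f g = g ¬p

  ∣∪∣≤ : ∀ (X Y : Subset n) → ∣ X ∪ Y ∣ ≤ ∣ X ∣ + ∣ Y ∣
  ∣∪∣≤ [] [] = z≤n
  ∣∪∣≤ (true ∷ X) (true ∷ Y) = s≤s (ℕₚ.≤-trans (∣∪∣≤ X Y) (ℕₚ.+-monoʳ-≤ ∣ X ∣ (ℕₚ.n≤1+n _)))
  ∣∪∣≤ (true ∷ X) (false ∷ Y) = s≤s (∣∪∣≤ X Y)
  ∣∪∣≤ (false ∷ X) (true ∷ Y) = ℕₚ.≤-trans (s≤s (∣∪∣≤ X Y)) (ℕₚ.≤-reflexive (sym (ℕₚ.+-suc ∣ X ∣ ∣ Y ∣)))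
  ∣∪∣≤ (false ∷ X) (false ∷ Y) = ∣∪∣≤ X Y

  ∣cover∣≤ : ∀ {T X Y : Subset n} → (∀ {v} → v ∈ T → v ∈ X ⊎ v ∈ Y) → ∣ T ∣ ≤ ∣ X ∣ + ∣ Y ∣
  ∣cover∣≤ {X = X} {Y} cov =
    ℕₚ.≤-trans (Subₚ.p⊆q⇒∣p∣≤∣q∣ (λ v∈ → Subₚ.x∈p∪q⁺ (cov v∈))) (∣∪∣≤ X Y)

  ∣disjoint∣≤ : ∀ {X Y Z : Subset n} → X ⊆ Z → Y ⊆ Z → (∀ {v} → v ∈ X → v ∈ Y → Absurd) →
                ∣ X ∣ + ∣ Y ∣ ≤ ∣ Z ∣
  ∣disjoint∣≤ {X = X} {Y} {Z} X⊆ Y⊆ dis =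
    ℕₚ.≤-trans (go X Y dis) (Subₚ.p⊆q⇒∣p∣≤∣q∣ (λ v∈ → [ X⊆ , Y⊆ ]′ (Subₚ.x∈p∪q⁻ X Y v∈)))
    where
    go : ∀ {m} (A B : Subset m) → (∀ {v} → v ∈ A → v ∈ B → Absurd) → ∣ A ∣ + ∣ B ∣ ≤ ∣ A ∪ B ∣
    go [] [] d = z≤n
    go (true ∷ A) (true ∷ B) d = ⊥-elim (d here here)
    go (true ∷ A) (false ∷ B) d = s≤s (go A B (λ a b → d (there a) (there b)))
    go (false ∷ A) (true ∷ B) d = ℕₚ.≤-trans (ℕₚ.≤-reflexive (ℕₚ.+-suc ∣ A ∣ ∣ B ∣))
                                    (s≤s (go A B (λ a b → d (there a) (there b))))
    go (false ∷ A) (false ∷ B) d = go A B (λ a b → d (there a) (there b))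

  ∣▹∣ : ∀ {X : Subset n} {v} → v ∉ X → ∣ X ▹ v ∣ ≡ suc ∣ X ∣
  ∣▹∣ {X = X} {v} v∉ = ℕₚ.≤-antisym
    (ℕₚ.≤-trans (∣∪∣≤ X ⁅ v ⁆) (ℕₚ.≤-reflexive (trans (cong (∣ X ∣ +_) (Subₚ.∣⁅x⁆∣≡1 v)) (ℕₚ.+-comm ∣ X ∣ 1))))
    (ℕₚ.≤-trans (ℕₚ.≤-reflexive (trans (ℕₚ.+-comm 1 ∣ X ∣) (cong (∣ X ∣ +_) (sym (Subₚ.∣⁅x⁆∣≡1 v)))))
      (∣disjoint∣≤ old (λ u∈ → subst (_∈ X ▹ v) (sym (Subₚ.x∈⁅y⁆⇒x≡y v u∈)) new)
        (λ u∈X u∈v → v∉ (subst (_∈ X) (Subₚ.x∈⁅y⁆⇒x≡y v u∈v) u∈X))))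

  -- Enumerating subsets, removing and adjoining elements

  elems : Subset n → List (Fin n)
  elems [] = []
  elems (true ∷ X) = zero ∷ map suc (elems X)
  elems (false ∷ X) = map suc (elems X)

  length-elems : (X : Subset n) → length (elems X) ≡ ∣ X ∣
  length-elems [] = refl
  length-elems (true ∷ X) = cong suc (trans (Listₚ.length-map suc (elems X)) (length-elems X))
  length-elems (false ∷ X) = trans (Listₚ.length-map suc (elems X)) (length-elems X)

  length-elems≤ : (X : Subset n) → length (elems X) *ℕ 1 ≤ n
  length-elems≤ X = ℕₚ.≤-trans (ℕₚ.≤-reflexive (trans (ℕₚ.*-identityʳ _) (length-elems X))) (Subₚ.∣p∣≤n X)

  ∈-elems⁺ : ∀ {X : Subset n} {v} → v ∈ X → v ∈ₗ elems X
  ∈-elems⁺ {X = true ∷ X} here = Any.here refl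
  ∈-elems⁺ {X = true ∷ X} (there v∈) = Any.there (∈-map⁺ suc (∈-elems⁺ v∈))
  ∈-elems⁺ {X = false ∷ X} (there v∈) = ∈-map⁺ suc (∈-elems⁺ v∈)

  ∈-elems⁻ : ∀ {X : Subset n} {v} → v ∈ₗ elems X → v ∈ X
  ∈-elems⁻ {X = true ∷ X} (Any.here refl) = here
  ∈-elems⁻ {X = true ∷ X} (Any.there v∈) with ∈-map⁻ suc v∈
  ... | u , u∈ , refl = there (∈-elems⁻ u∈)
  ∈-elems⁻ {X = false ∷ X} v∈ with ∈-map⁻ suc v∈
  ... | u , u∈ , refl = there (∈-elems⁻ u∈)

  infixl 6 _∖_
  _∖_ : Subset n → Subset n → Subset n
  X ∖ Y = select (λ v → (v ∈? X) ×-dec ¬? (v ∈? Y))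

  module _ {X Y : Subset n} where
    private
      member? : ∀ v → Dec (v ∈ X × v ∉ Y)
      member? v = (v ∈? X) ×-dec ¬? (v ∈? Y)

    ∖⁺ : ∀ {v} → v ∈ X → v ∉ Y → v ∈ X ∖ Y
    ∖⁺ v∈ v∉ = ∈-select⁺ member? (v∈ , v∉)

    ∖⁻ : ∀ {v} → v ∈ X ∖ Y → v ∈ X × v ∉ Y
    ∖⁻ = ∈-select⁻ member?

  module _ {X : Subset n} {x : Fin n} where
    ∖₁⁺ : ∀ {v} → v ∈ X → v ≢ x → v ∈ X ∖ ⁅ x ⁆
    ∖₁⁺ v∈ ne = ∖⁺ v∈ (λ v∈x → ne (Subₚ.x∈⁅y⁆⇒x≡y x v∈x))

    ∖₁⁻ : ∀ {v} → v ∈ X ∖ ⁅ x ⁆ → v ∈ X × v ≢ x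
    ∖₁⁻ v∈ = let (v∈X , v∉) = ∖⁻ v∈ in v∈X , λ { refl → v∉ (Subₚ.x∈⁅x⁆ x) }

  ∣∖₁∣ : ∀ {X : Subset n} {x} → x ∈ X → suc ∣ X ∖ ⁅ x ⁆ ∣ ≡ ∣ X ∣
  ∣∖₁∣ {X = X} {x} x∈X = trans (sym (∣▹∣ (λ x∈ → proj₂ (∖₁⁻ x∈) refl)))
    (cong ∣_∣ (Subₚ.⊆-antisym (▹-⊆ (λ v∈ → proj₁ (∖₁⁻ v∈)) x∈X) back))
    where
    back : X ⊆ X ∖ ⁅ x ⁆ ▹ x
    back {v} v∈ with v Finₚ.≟ x
    ... | yes refl = new
    ... | no ne = old (∖₁⁺ v∈ ne)

  adjoin : Subset n → List (Fin n) → Subset n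
  adjoin A [] = A
  adjoin A (x ∷ xs) = adjoin (A ▹ x) xs

  adjoin⁺ : ∀ {A : Subset n} xs {v} → v ∈ A ⊎ v ∈ₗ xs → v ∈ adjoin A xs
  adjoin⁺ [] (inj₁ v∈) = v∈
  adjoin⁺ (x ∷ xs) (inj₁ v∈) = adjoin⁺ xs (inj₁ (old v∈))
  adjoin⁺ (x ∷ xs) (inj₂ (Any.here refl)) = adjoin⁺ xs (inj₁ new)
  adjoin⁺ (x ∷ xs) (inj₂ (Any.there v∈)) = adjoin⁺ xs (inj₂ v∈)

  adjoin⁻ : ∀ {A : Subset n} xs {v} → v ∈ adjoin A xs → v ∈ A ⊎ v ∈ₗ xs
  adjoin⁻ [] v∈ = inj₁ v∈
  adjoin⁻ (x ∷ xs) v∈ with adjoin⁻ xs v∈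
  ... | inj₂ v∈xs = inj₂ (Any.there v∈xs)
  ... | inj₁ v∈Ax with ▹⁻ v∈Ax
  ... | inj₁ v∈A = inj₁ v∈A
  ... | inj₂ refl = inj₂ (Any.here refl)

  -- Finite sums and price levels

  Σ< : ℕ → (ℕ → ℕ) → ℕ
  Σ< zero f = 0
  Σ< (suc k) f = Σ< k f + f k

  Σ<-mono : ∀ k {f g} → (∀ t → t < k → f t ≤ g t) → Σ< k f ≤ Σ< k g
  Σ<-mono zero h = z≤n
  Σ<-mono (suc k) h = ℕₚ.+-mono-≤ (Σ<-mono k (λ t t< → h t (ℕₚ.m<n⇒m<1+n t<))) (h k ℕₚ.≤-refl)

  Σ<-+ : ∀ k f g → Σ< k (λ t → f t + g t) ≡ Σ< k f + Σ< k g
  Σ<-+ zero f g = refl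
  Σ<-+ (suc k) f g = trans (cong (_+ (f k + g k)) (Σ<-+ k f g)) (interchange (Σ< k f) _ _ _)
    where open import Algebra.Properties.CommutativeSemigroup ℕₚ.+-commutativeSemigroup using (interchange)

  Σ<-const : ∀ k c → Σ< k (λ _ → c) ≡ k *ℕ c
  Σ<-const zero c = refl
  Σ<-const (suc k) c = trans (cong (_+ c) (Σ<-const k c)) (ℕₚ.+-comm (k *ℕ c) c)

  Σ<-shift : ∀ k f → Σ< k (λ t → f (suc t)) + f 0 ≡ Σ< k f + f k
  Σ<-shift zero f = refl
  Σ<-shift (suc k) f = trans (trans (ℕₚ.+-assoc (Σ< k (λ t → f (suc t))) _ _)
      (trans (cong (Σ< k (λ t → f (suc t)) +_) (ℕₚ.+-comm (f (suc k)) (f 0)))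
        (sym (ℕₚ.+-assoc (Σ< k (λ t → f (suc t))) _ _))))
    (cong (_+ f (suc k)) (Σ<-shift k f))

  module _ (p : Fin n → ℕ) (X : Subset n) where
    private
      level? : ∀ s v → Dec (v ∈ X × p v ≡ s)
      level? s v = (v ∈? X) ×-dec (p v ℕ.≟ s)
      below? : ∀ s v → Dec (v ∈ X × p v < s)
      below? s v = (v ∈? X) ×-dec (p v <? s)
      atLeast? : ∀ s v → Dec (v ∈ X × s ≤ p v)
      atLeast? s v = (v ∈? X) ×-dec (s ≤? p v)

    level below atLeast : ℕ → Subset n
    level s = select (level? s)
    below s = select (below? s)
    atLeast s = select (atLeast? s)

    ∈-level⁺ : ∀ {v s} → v ∈ X → p v ≡ s → v ∈ level s
    ∈-level⁺ {s = s} v∈ e = ∈-select⁺ (level? s) (v∈ , e)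
    ∈-level⁻ : ∀ {v s} → v ∈ level s → v ∈ X × p v ≡ s
    ∈-level⁻ {s = s} = ∈-select⁻ (level? s)
    ∈-below⁺ : ∀ {v s} → v ∈ X → p v < s → v ∈ below s
    ∈-below⁺ {s = s} v∈ e = ∈-select⁺ (below? s) (v∈ , e)
    ∈-below⁻ : ∀ {v s} → v ∈ below s → v ∈ X × p v < s
    ∈-below⁻ {s = s} = ∈-select⁻ (below? s)
    ∈-atLeast⁺ : ∀ {v s} → v ∈ X → s ≤ p v → v ∈ atLeast s
    ∈-atLeast⁺ {s = s} v∈ e = ∈-select⁺ (atLeast? s) (v∈ , e)
    ∈-atLeast⁻ : ∀ {v s} → v ∈ atLeast s → v ∈ X × s ≤ p v
    ∈-atLeast⁻ {s = s} = ∈-select⁻ (atLeast? s)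

    Σ-level≤ : ∀ k → Σ< k (λ t → ∣ level t ∣) ≤ ∣ X ∣
    Σ-level≤ k = ℕₚ.≤-trans (go k) (Subₚ.p⊆q⇒∣p∣≤∣q∣ {p = below k} {X} (λ v∈ → proj₁ (∈-below⁻ v∈)))
      where
      go : ∀ k → Σ< k (λ t → ∣ level t ∣) ≤ ∣ below k ∣
      go zero = z≤n
      go (suc k) = ℕₚ.≤-trans (ℕₚ.+-monoˡ-≤ _ (go k)) (∣disjoint∣≤ {X = below k} {level k} {below (suc k)}
        (λ v∈ → let (a , b) = ∈-below⁻ v∈ in ∈-below⁺ a (ℕₚ.m<n⇒m<1+n b))
        (λ v∈ → let (a , b) = ∈-level⁻ v∈ in ∈-below⁺ a (s≤s (ℕₚ.≤-reflexive b)))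
        (λ v∈ v∈' → ℕₚ.<-irrefl (proj₂ (∈-level⁻ v∈')) (proj₂ (∈-below⁻ v∈))))

  level-⊆ : ∀ {p : Fin n → ℕ} {X Y u} → X ⊆ Y → level p X u ⊆ level p Y u
  level-⊆ {p = p} {X} {Y} X⊆Y v∈ with ∈-level⁻ p X v∈
  ... | v∈X , e = ∈-level⁺ p Y (X⊆Y v∈X) e

  atLeast-⊆ : ∀ {p : Fin n → ℕ} {X Y u} → X ⊆ Y → atLeast p X u ⊆ atLeast p Y u
  atLeast-⊆ {p = p} {X} {Y} X⊆Y v∈ with ∈-atLeast⁻ p X v∈
  ... | v∈X , e = ∈-atLeast⁺ p Y (X⊆Y v∈X) e

  -- Adaptive query programs

  -- Bind is a constructor, so that values, costs and the truncation of a program are structural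
  -- recursions over it.
  data Q (n : ℕ) : Set → Set₁ where
    ret   : ∀ {A} → A → Q n A
    ask   : Bool → Subset n → Q n Bool
    _>>=_ : ∀ {A B} → Q n A → (A → Q n B) → Q n B

  infixl 1 _>>=_

  private variable
    A B : Set

  toTree : Q n A → (A → QueryTree n) → QueryTree n
  toTree (ret a) k = k a
  toTree (ask i X) k = query i X k
  toTree (m >>= f) k = toTree m (λ a → toTree (f a) k)

  oracle : Oracle n → Oracle n → Bool → Oracle n
  oracle I₁ I₂ false = I₁
  oracle I₁ I₂ true = I₂

  val : (Bool → Oracle n) → Q n A → A
  val O (ret a) = a
  val O (ask i X) = O i X
  val O (m >>= f) = val O (f (val O m))

  cost : (Bool → Oracle n) → Q n A → ℕ
  cost O (ret a) = 0
  cost O (ask i X) = 1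
  cost O (m >>= f) = cost O m + cost O (f (val O m))

  run-toTree : (I₁ I₂ : Oracle n) (m : Q n A) (k : A → QueryTree n) →
    let O = oracle I₁ I₂ in
    run I₁ I₂ (toTree m k) ≡
      (proj₁ (run I₁ I₂ (k (val O m))) , cost O m + proj₂ (run I₁ I₂ (k (val O m))))
  run-toTree I₁ I₂ (ret a) k = refl
  run-toTree I₁ I₂ (ask false X) k = refl
  run-toTree I₁ I₂ (ask true X) k = refl
  run-toTree I₁ I₂ (m >>= f) k
    rewrite run-toTree I₁ I₂ m (λ a → toTree (f a) k)
          | run-toTree I₁ I₂ (f (val (oracle I₁ I₂) m)) k
    = cong₂ _,_ refl (sym (ℕₚ.+-assoc (cost (oracle I₁ I₂) m) _ _))

  record Run (O : Bool → Oracle n) (m : Q n A) (c : ℕ) (P : A → Set) : Set where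
    constructor mkRun
    field
      cost≤ : cost O m ≤ c
      post  : P (val O m)
  open Run

  module _ {O : Bool → Oracle n} where
    run-ret : ∀ {a : A} {P c} → P a → Run O (ret a) c P
    run-ret Pa = mkRun z≤n Pa

    run-bind : ∀ {m : Q n A} {f : A → Q n B} {c d P R} →
               Run O m c P → (∀ a → P a → Run O (f a) d R) → Run O (m >>= f) (c + d) R
    run-bind r g = mkRun (ℕₚ.+-mono-≤ (cost≤ r) (cost≤ rest)) (post rest)
      where rest = g _ (post r)

    run-ask : ∀ i X → Run O (ask i X) 1 (λ b → O i X ≡ b)
    run-ask i X = mkRun ℕₚ.≤-refl refl

    run-weaken : ∀ {m : Q n A} {c d P R} → c ≤ d → (∀ a → P a → R a) → Run O m c P → Run O m d R
    run-weaken c≤d P⊆R r = mkRun (ℕₚ.≤-trans (cost≤ r) c≤d) (P⊆R _ (post r))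

    run-≤ : ∀ {m : Q n A} {c d P} → c ≤ d → Run O m c P → Run O m d P
    run-≤ c≤d = run-weaken c≤d (λ _ Pa → Pa)

  -- Unlike Run, this allows amortised bounds that depend on the result.
  record Spec (O : Bool → Oracle n) (m : Q n A) (P : A → ℕ → Set) : Set where
    constructor mkSpec
    field
      holds : P (val O m) (cost O m)
  open Spec

  module _ {O : Bool → Oracle n} where
    spec-bind : ∀ {m : Q n A} {f : A → Q n B} {P R} →
                Spec O m P → (∀ a c → P a c → Spec O (f a) (λ b d → R b (c + d))) → Spec O (m >>= f) R
    spec-bind s g = mkSpec (holds (g _ _ (holds s)))

    spec-run : ∀ {m : Q n A} {c P} → Run O m c P → Spec O m (λ a q → q ≤ c × P a)
    spec-run r = mkSpec (cost≤ r , post r)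

    spec-weaken : ∀ {m : Q n A} {P R : A → ℕ → Set} → (∀ a q → P a q → R a q) → Spec O m P → Spec O m R
    spec-weaken h s = mkSpec (h _ _ (holds s))

  -- Matroids

  dependent : ∀ {I : Oracle n} {X} → I X ≡ false → ¬ Indep I X
  dependent no-i i with trans (sym i) no-i
  ... | ()

  module Matroid {I : Oracle n} (M : IsMatroid I) where
    open IsMatroid M

    -- For independent `X` this is the closure; the first disjunct is needed because `X ▹ v` is `X`
    -- itself when `v` lies in `X`. A dependent `X` spans everything.
    Span : Subset n → Fin n → Set
    Span X v = v ∈ X ⊎ ¬ Indep I (X ▹ v)

    indep? : ∀ X → Dec (Indep I X)
    indep? X = I X Boolₚ.≟ true

    indep-⊥ : Indep I ⊥
    indep-⊥ = downClosed Subₚ.⊥⊆ (proj₂ nonempty)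

    span-mono : ∀ {X Y v} → X ⊆ Y → Span X v → Span Y v
    span-mono X⊆Y (inj₁ v∈) = inj₁ (X⊆Y v∈)
    span-mono X⊆Y (inj₂ ¬i) = inj₂ (λ i → ¬i (downClosed (▹-mono X⊆Y) i))

    -- Otherwise exchange would add to `X` an element of `Y` that `X` already spans. All rank
    -- comparisons below are instances.
    spanned-≤ : ∀ {X Y} → Indep I X → Indep I Y → (∀ {v} → v ∈ Y → Span X v) → ∣ Y ∣ ≤ ∣ X ∣
    spanned-≤ {X} {Y} iX iY sp with ∣ Y ∣ ≤? ∣ X ∣
    ... | yes le = le
    ... | no gt with exchange iY iX (ℕₚ.≰⇒> gt)
    ... | x , x∈Y , x∉X , i with sp x∈Y
    ... | inj₁ x∈X = contradiction x∈X x∉X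
    ... | inj₂ ¬i = contradiction i ¬i

    -- X is grown by exchange against W ▹ y; it cannot reach size ∣ W ▹ y ∣ inside the
    -- span of W, so y itself gets added at some point.
    indep-▹ : ∀ {X W y} → Indep I X → (∀ {v} → v ∈ X → Span W v) → Indep I (W ▹ y) → y ∉ W →
              Indep I (X ▹ y)
    indep-▹ {X₀} {W} {y} iX₀ sp₀ iWy y∉W = go ∣ W ▹ y ∣ iX₀ sp₀ (ℕₚ.m≤m+n _ ∣ X₀ ∣)
      where
      go : ∀ d {X} → Indep I X → (∀ {v} → v ∈ X → Span W v) → ∣ W ▹ y ∣ ≤ d + ∣ X ∣ → Indep I (X ▹ y)
      go zero {X} iX sp le = contradiction
        (ℕₚ.≤-trans (ℕₚ.≤-reflexive (sym (∣▹∣ y∉W))) (ℕₚ.≤-trans le (spanned-≤ (downClosed old iWy) iX sp)))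
        (ℕₚ.<-irrefl refl)
      go (suc d) {X} iX sp le with ∣ X ∣ <? ∣ W ▹ y ∣
      ... | no ge = go d iX sp (ℕₚ.≤-trans (ℕₚ.≮⇒≥ ge) (ℕₚ.m≤n+m ∣ X ∣ d))
      ... | yes lt with exchange iWy iX lt
      ... | z , z∈ , z∉X , iXz with ▹⁻ z∈
      ... | inj₂ refl = iXz
      ... | inj₁ z∈W = downClosed (▹-mono old) (go d {X ▹ z} iXz sp'
            (ℕₚ.≤-trans le (ℕₚ.≤-reflexive (trans (sym (ℕₚ.+-suc d ∣ X ∣)) (cong (d +_) (sym (∣▹∣ z∉X)))))))
        where
        sp' : ∀ {v} → v ∈ X ▹ z → Span W v
        sp' v∈ with ▹⁻ v∈
        ... | inj₁ v∈X = sp v∈X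
        ... | inj₂ refl = inj₁ z∈W

    -- Contrapositive of `indep-▹`: if `X ▹ v` were independent, then `Y ▹ v` would be too.
    span-trans : ∀ {X Y v} → Indep I Y → (∀ {u} → u ∈ Y → Span X u) → Span Y v → Span X v
    span-trans iY sp (inj₁ v∈Y) = sp v∈Y
    span-trans {X} {v = v} iY sp (inj₂ ¬i) with v ∈? X
    ... | yes v∈X = inj₁ v∈X
    ... | no v∉X = inj₂ (λ i → ¬i (indep-▹ iY sp i v∉X))

  -- Growing a set greedily

  grow : (Fin n → Subset n → Q n Bool) → List (Fin n) → Subset n → Q n (Subset n)
  grow test [] X = ret X
  grow test (v ∷ vs) X = test v X >>= λ b → grow test vs (if b then X ▹ v else X)

  module _ {O : Bool → Oracle n} {test : Fin n → Subset n → Q n Bool} {c : ℕ}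
           {T : Fin n → Subset n → Bool → Set} (run-test : ∀ v X → Run O (test v X) c (T v X))
           (Inv : Subset n → Set) where

    -- The refusal is recorded for the stage `Y` at which it happened; where the test depends on
    -- that stage, monotonicity of dependence carries it to the final set.
    Rejected : Fin n → Subset n → Set
    Rejected v X = ∃[ Y ] (Inv Y × Y ⊆ X × T v Y false)

    record Grown (vs : List (Fin n)) (X X′ : Subset n) : Set where
      field
        inv : Inv X′
        ext : X ⊆ X′
        maximal : ∀ {v} → v ∈ₗ vs → v ∈ X′ ⊎ Rejected v X′

    run-grow : ∀ vs {X} → (∀ {v Y} → v ∈ₗ vs → Inv Y → T v Y true → Inv (Y ▹ v)) → Inv X →
               Run O (grow test vs X) (length vs *ℕ c) (Grown vs X)
    run-grow [] step iX = run-ret (record { inv = iX ; ext = λ v∈ → v∈ ; maximal = λ () })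
    run-grow (v ∷ vs) {X} step iX = run-bind (run-test v X) next
      where
      next : ∀ b → T v X b → Run O (grow test vs (if b then X ▹ v else X)) (length vs *ℕ c) (Grown (v ∷ vs) X)
      next true t = run-weaken ℕₚ.≤-refl
        (λ X′ g → let open Grown g in record
          { inv = inv ; ext = λ u∈ → ext (old u∈)
          ; maximal = λ { (Any.here refl) → inj₁ (ext new) ; (Any.there u∈) → maximal u∈ } })
        (run-grow vs (λ u∈ → step (Any.there u∈)) (step (Any.here refl) iX t))
      next false t = run-weaken ℕₚ.≤-refl
        (λ X′ g → let open Grown g in record
          { inv = inv ; ext = ext
          ; maximal = λ { (Any.here refl) → inj₂ (X , iX , ext , t) ; (Any.there u∈) → maximal u∈ } })
        (run-grow vs (λ u∈ → step (Any.there u∈)) iX)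

  -- Auction

  module AuctionProgram {n : ℕ} (K : ℕ) where

    -- Each basis extends the one of the next lower threshold, so the whole chain costs one query
    -- per element.
    bases : (Fin n → ℕ) → ℕ → Q n (ℕ → Subset n)
    bases p zero = ret (λ _ → ⊥)
    bases p (suc k) =
      bases p k >>= λ B →
      grow (λ v X → ask false (X ▹ v)) (elems (level p ⊤ k)) (B k) >>= λ X →
      ret (λ u → if does (u ≤? k) then B u else X)

    -- With `B` a basis of the elements cheaper than `s`, the second query decides independence of
    -- level `s` in M₁ contracted by everything cheaper.
    bid : (Fin n → ℕ) → Subset n → ℕ → Fin n → Subset n → Q n Bool
    bid p B s v X =
      ask true (X ▹ v) >>= λ b →
      if b then ask false ((B ∪ level p X s) ▹ v) else ret false

    -- Levels are served from the top, and within a level the incumbents J before the newcomers: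
    -- an incumbent can then only be displaced by elements that are at least as expensive.
    assign : (Fin n → ℕ) → (ℕ → Subset n) → Subset n → ℕ → ℕ → Q n (Subset n)
    assign p B J zero s = ret ⊥
    assign p B J (suc k) s =
      assign p B J k (suc s) >>= λ X →
      grow (bid p (B s) s) (elems (level p J s)) X >>= λ X₁ →
      grow (bid p (B s) s) (elems (level p (∁ J) s)) X₁

    -- Elements of `J` of equal price compete as well, since they are held at that price plus one.
    outbid : (Fin n → ℕ) → Subset n → Fin n → Q n Bool
    outbid p J v = ask true (atLeast p J (p v) ▹ v) >>= λ b → ret (not b)

    raise : (Fin n → ℕ) → Subset n → Fin n → ℕ
    raise p R v = if does (v ∈? R) then suc (p v) else p v

    -- Only elements priced below `K` can become dearer; one that has reached `K` has left the
    -- auction.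
    round : (Fin n → ℕ) → Subset n → Q n (Subset n × Subset n × ℕ)
    round p J =
      bases p K >>= λ B →
      assign p B J K 0 >>= λ J′ →
      grow (λ v _ → outbid p J′ v) (elems (below p (∁ J′) K)) ⊥ >>= λ R →
      ret (J′ , R , ∣ B K ∣ ∸ ∣ J′ ∣)

    -- The halting test holds when the error term K a of the duality bound can be paid with one
    -- further |J′|, which turns K + 1 into K + 2.
    auction : ℕ → (Fin n → ℕ) → Subset n → Q n (Subset n)
    auction zero p J = ret J
    auction (suc f) p J = round p J >>= λ (J′ , R , a) →
      if does (K *ℕ a ≤? ∣ J′ ∣) then ret J′ else auction f (raise p R) J′

  module Auction {n : ℕ} {I₁ I₂ : Oracle n} (M₁ : IsMatroid I₁) (M₂ : IsMatroid I₂) (K : ℕ) where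
    open AuctionProgram {n} K
    module M₁ = Matroid M₁
    module M₂ = Matroid M₂
    open IsMatroid M₁ using () renaming (downClosed to down₁)
    open IsMatroid M₂ using () renaming (downClosed to down₂)

    O : Bool → Oracle n
    O = oracle I₁ I₂

    -- An element of J of price s is held at s + 1, so atLeast p J t is what is held above t.
    record Inv (p : Fin n → ℕ) (J : Subset n) : Set where
      field
        common : CommonIndep I₁ I₂ J
        <K     : ∀ {v} → v ∈ J → p v < K
        priced : ∀ {v t} → p v ≡ suc t → M₂.Span (atLeast p J t) v
        -- Quantifying over `W` lets this survive a rise of prices, which only shrinks the
        -- collection of admissible `W`.
        free₁  : ∀ u {W} → Indep I₁ W → (∀ {v} → v ∈ W → p v < u) → Indep I₁ (W ∪ level p J u)

    -- With maximal W this sum is K · rank M₁ minus the price of a cheapest basis.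
    Potential≤ : (Fin n → ℕ) → ℕ → Set
    Potential≤ p q = (W : ℕ → Subset n) → (∀ {t} → t ≤ K → Indep I₁ (W t)) →
                     (∀ {t v} → t ≤ K → v ∈ W t → p v < t) →
                     Σ< K (λ t → ∣ W (suc t) ∣) ≤ q

    -- Auction: M₁-bases of the price thresholds

    module _ (p : Fin n → ℕ) where
      record Basis (u : ℕ) (B : Subset n) : Set where
        field
          indep  : Indep I₁ B
          lower  : ∀ {v} → v ∈ B → p v < u
          spans  : ∀ {v} → p v < u → M₁.Span B v

      run-bases : ∀ k → Run O (bases p k) (Σ< k (λ t → ∣ level p ⊤ t ∣)) (λ B → ∀ u → u ≤ k → Basis u (B u))
      run-bases zero = run-ret (λ { .0 z≤n → record
        { indep = M₁.indep-⊥ ; lower = λ v∈ → contradiction v∈ Subₚ.∉⊥ ; spans = λ () } })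
      run-bases (suc k) = run-bind (run-bases k) λ B isB →
        run-≤ (ℕₚ.≤-reflexive (trans (ℕₚ.+-identityʳ _) (trans (ℕₚ.*-identityʳ _) (length-elems (level p ⊤ k)))))
          (run-bind
            (run-grow {T = λ v X b → I₁ (X ▹ v) ≡ b} (λ v X → run-ask false (X ▹ v))
              (λ X → Indep I₁ X × (∀ {v} → v ∈ X → p v < suc k)) (elems (level p ⊤ k))
              (λ v∈ (iY , lo) i → i , λ u∈ → [ lo , (λ { refl → s≤s (ℕₚ.≤-reflexive (proj₂ (∈-level⁻ p ⊤ (∈-elems⁻ v∈)))) }) ]′ (▹⁻ u∈))
              (Basis.indep (isB k ℕₚ.≤-refl) , λ v∈ → ℕₚ.m<n⇒m<1+n (Basis.lower (isB k ℕₚ.≤-refl) v∈)))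
            (λ X g → run-ret {c = 0} (ext-basis B isB X g)))
        where
        ext-basis : ∀ B → (∀ u → u ≤ k → Basis u (B u)) → ∀ X → Grown _ _ (elems (level p ⊤ k)) (B k) X →
                    ∀ u → u ≤ suc k → Basis u (if does (u ≤? k) then B u else X)
        ext-basis B isB X g u u≤ = if-elim (Basis u) (u ≤? k) (isB u) λ u≰k →
          subst (λ w → Basis w X) (ℕₚ.≤-antisym (ℕₚ.≰⇒> u≰k) u≤)
            record { indep = proj₁ inv ; lower = λ v∈ → proj₂ inv v∈ ; spans = spans }
          where
          open Grown g
          spans : ∀ {v} → p v < suc k → M₁.Span X v
          spans {v} lt with p v ℕ.≟ k
          ... | no ne = M₁.span-mono ext (Basis.spans (isB k ℕₚ.≤-refl) (ℕₚ.≤∧≢⇒< (ℕₚ.≤-pred lt) ne))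
          ... | yes e with maximal (∈-elems⁺ (∈-level⁺ p ⊤ Subₚ.∈⊤ e))
          ... | inj₁ v∈X = inj₁ v∈X
          ... | inj₂ (Y , _ , Y⊆X , no-i) = M₁.span-mono Y⊆X (inj₂ (dependent {I = I₁} no-i))

      -- Auction: rebuilding J level by level

      module _ (B : ℕ → Subset n) (isB : ∀ u → u ≤ K → Basis u (B u)) {J : Subset n} (invJ : Inv p J) where

        -- `keep` carries the M₂-spans of the old set over to the new one and so preserves `priced`;
        -- `full` says that whatever M₂ does not reject is spanned in M₁, which drives the
        -- potential.
        record Assigned (s : ℕ) (X : Subset n) : Set where
          field
            indep₂ : Indep I₂ X
            range  : ∀ {v} → v ∈ X → s ≤ p v × p v < K
            keep   : ∀ {v} → v ∈ J → s ≤ p v → v ∈ X ⊎ ¬ Indep I₂ (atLeast p X (p v) ▹ v)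
            free₁  : ∀ {u W} → s ≤ u → Indep I₁ W → (∀ {v} → v ∈ W → p v < u) →
                     Indep I₁ (W ∪ level p X u)
            full   : ∀ {v} → s ≤ p v → p v < K →
                     ¬ Indep I₂ (atLeast p X (p v) ▹ v) ⊎ M₁.Span (B (p v) ∪ level p X (p v)) v

        module _ {s : ℕ} (s<K : s < K) {X : Subset n} (asX : Assigned (suc s) X) where
          private module X = Assigned asX

          Tried : Fin n → Subset n → Bool → Set
          Tried v Y true = Indep I₂ (Y ▹ v) × Indep I₁ ((B s ∪ level p Y s) ▹ v)
          Tried v Y false = ¬ Indep I₂ (Y ▹ v) ⊎ ¬ Indep I₁ ((B s ∪ level p Y s) ▹ v)

          run-bid : ∀ v Y → Run O (bid p (B s) s v Y) 2 (Tried v Y)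
          run-bid v Y = run-bind (run-ask true (Y ▹ v)) next
            where
            next : ∀ b → I₂ (Y ▹ v) ≡ b →
                   Run O (if b then ask false ((B s ∪ level p Y s) ▹ v) else ret false) 1 (Tried v Y)
            next false d = run-ret (inj₁ (dependent {I = I₂} d))
            next true i = run-weaken ℕₚ.≤-refl
              (λ { true j → i , j ; false d → inj₂ (dependent {I = I₁} d) })
              (run-ask false ((B s ∪ level p Y s) ▹ v))

          -- `Src` tells where the elements of level `s` come from: `J` while the incumbents are
          -- served, afterwards `⊤`.
          record Partial (Src Y : Subset n) : Set where
            field
              ext    : X ⊆ Y
              indep₂ : Indep I₂ Y
              from   : ∀ {v} → v ∈ Y → v ∈ X ⊎ (v ∈ Src × p v ≡ s)
              free₁  : ∀ {W} → Indep I₁ W → (∀ {v} → v ∈ W → p v < s) → Indep I₁ (W ∪ level p Y s)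

          partial-⊥ : Partial J X
          partial-⊥ = record
            { ext = λ v∈ → v∈ ; indep₂ = X.indep₂ ; from = inj₁
            ; free₁ = λ iW _ → down₁ (∪-⊥ˡ none) iW }
            where
            none : ∀ {v} → v ∉ level p X s
            none v∈ with ∈-level⁻ p X v∈
            ... | v∈X , refl = contradiction (proj₁ (X.range v∈X)) (ℕₚ.<-irrefl refl)

          -- The query was made over `B s` only, but every admissible `W` is spanned by `B s`, so by
          -- `indep-▹` the answer is valid over `W` too.
          partial-step : ∀ {Src v Y} → v ∈ Src → p v ≡ s → Partial Src Y → Tried v Y true → Partial Src (Y ▹ v)
          partial-step {Src} {v} {Y} v∈Src refl par (i₂ , i₁) = record
            { ext = λ u∈ → old (ext u∈)
            ; indep₂ = i₂
            ; from = λ u∈ → [ from , (λ { refl → inj₂ (v∈Src , refl) }) ]′ (▹⁻ u∈)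
            ; free₁ = free′ }
            where
            open Partial par
            free′ : ∀ {W} → Indep I₁ W → (∀ {u} → u ∈ W → p u < s) → Indep I₁ (W ∪ level p (Y ▹ v) s)
            free′ {W} iW lo with v ∈? Y
            ... | yes v∈Y = down₁ (λ u∈ → Subₚ.x∈p∪q⁺ (shrink (Subₚ.x∈p∪q⁻ W _ u∈))) (free₁ iW lo)
              where
              shrink : ∀ {u} → u ∈ W ⊎ u ∈ level p (Y ▹ v) s → u ∈ W ⊎ u ∈ level p Y s
              shrink (inj₁ u∈W) = inj₁ u∈W
              shrink (inj₂ u∈) with ∈-level⁻ p (Y ▹ v) u∈
              ... | u∈Yv , e = inj₂ (∈-level⁺ p Y ([ (λ h → h) , (λ { refl → v∈Y }) ]′ (▹⁻ u∈Yv)) e)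
            ... | no v∉Y = down₁ (λ u∈ → split (Subₚ.x∈p∪q⁻ W _ u∈))
                (M₁.indep-▹ (free₁ iW lo) sp i₁ fresh)
              where
              split : ∀ {u} → u ∈ W ⊎ u ∈ level p (Y ▹ v) s → u ∈ (W ∪ level p Y s) ▹ v
              split (inj₁ u∈W) = old (Subₚ.x∈p∪q⁺ (inj₁ u∈W))
              split (inj₂ u∈) with ∈-level⁻ p (Y ▹ v) u∈
              ... | u∈Yv , e with ▹⁻ u∈Yv
              ... | inj₁ u∈Y = old (Subₚ.x∈p∪q⁺ (inj₂ (∈-level⁺ p Y u∈Y e)))
              ... | inj₂ refl = new
              sp : ∀ {u} → u ∈ W ∪ level p Y s → M₁.Span (B s ∪ level p Y s) u
              sp u∈ with Subₚ.x∈p∪q⁻ W _ u∈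
              ... | inj₁ u∈W = M₁.span-mono (λ w → Subₚ.x∈p∪q⁺ (inj₁ w)) (Basis.spans (isB s (ℕₚ.<⇒≤ s<K)) (lo u∈W))
              ... | inj₂ u∈L = inj₁ (Subₚ.x∈p∪q⁺ (inj₂ u∈L))
              fresh : v ∉ B s ∪ level p Y s
              fresh v∈ with Subₚ.x∈p∪q⁻ (B s) _ v∈
              ... | inj₁ v∈B = ℕₚ.<-irrefl refl (Basis.lower (isB s (ℕₚ.<⇒≤ s<K)) v∈B)
              ... | inj₂ v∈L = v∉Y (proj₁ (∈-level⁻ p Y v∈L))

          ⊆atLeast : ∀ {Src Y Z} → Partial Src Y → Y ⊆ Z → Y ⊆ atLeast p Z s
          ⊆atLeast {Z = Z} par Y⊆Z v∈ = ∈-atLeast⁺ p Z (Y⊆Z v∈) (≥s (Partial.from par v∈))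
            where
            ≥s : ∀ {v Src} → v ∈ X ⊎ (v ∈ Src × p v ≡ s) → s ≤ p v
            ≥s (inj₁ v∈X) = ℕₚ.<⇒≤ (proj₁ (X.range v∈X))
            ≥s (inj₂ (_ , e)) = ℕₚ.≤-reflexive (sym e)

          -- In the first phase the M₁-test cannot fail, because J is free over the lower levels.
          assigned-step : ∀ {X₁ X₂} →
            Grown run-bid (Partial J) (elems (level p J s)) X X₁ →
            Grown run-bid (Partial ⊤) (elems (level p (∁ J) s)) X₁ X₂ → Assigned s X₂
          assigned-step {X₁} {X₂} g₁ g₂ = record
            { indep₂ = indep₂ (inv g₂) ; range = range′ ; keep = keep′ ; free₁ = free′ ; full = full′ }
            where
            open Grown
            open Partial
            X⊆X₂ : X ⊆ X₂
            X⊆X₂ v∈ = ext g₂ (ext g₁ v∈)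
            range′ : ∀ {v} → v ∈ X₂ → s ≤ p v × p v < K
            range′ v∈ with from (inv g₂) v∈
            ... | inj₁ v∈X = let (a , b) = X.range v∈X in ℕₚ.<⇒≤ a , b
            ... | inj₂ (_ , refl) = ℕₚ.≤-refl , s<K
            keep-s : ∀ {v} → v ∈ J → p v ≡ s → v ∈ X₁ ⊎ ¬ Indep I₂ (atLeast p X₂ s ▹ v)
            keep-s {v} v∈J e with maximal g₁ (∈-elems⁺ (∈-level⁺ p J v∈J e))
            ... | inj₁ v∈X₁ = inj₁ v∈X₁
            ... | inj₂ (Y , par , Y⊆ , inj₁ d) = inj₂ (λ i → d (down₂ (▹-mono (⊆atLeast par (λ u∈ → ext g₂ (Y⊆ u∈)))) i))
            ... | inj₂ (Y , par , Y⊆ , inj₂ d) = contradiction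
                (down₁ (▹-⊆ inJ (Subₚ.x∈p∪q⁺ (inj₂ (∈-level⁺ p J v∈J e))))
                  (Inv.free₁ invJ s (Basis.indep (isB s (ℕₚ.<⇒≤ s<K))) (Basis.lower (isB s (ℕₚ.<⇒≤ s<K))))) d
              where
              inJ : B s ∪ level p Y s ⊆ B s ∪ level p J s
              inJ {u} u∈ with Subₚ.x∈p∪q⁻ (B s) _ u∈
              ... | inj₁ u∈B = Subₚ.x∈p∪q⁺ (inj₁ u∈B)
              ... | inj₂ u∈L with ∈-level⁻ p Y u∈L
              ... | u∈Y , refl with from par u∈Y
              ... | inj₁ u∈X = contradiction (proj₁ (X.range u∈X)) (ℕₚ.<-irrefl refl)
              ... | inj₂ (u∈J , _) = Subₚ.x∈p∪q⁺ (inj₂ (∈-level⁺ p J u∈J refl))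
            keep′ : ∀ {v} → v ∈ J → s ≤ p v → v ∈ X₂ ⊎ ¬ Indep I₂ (atLeast p X₂ (p v) ▹ v)
            keep′ {v} v∈J s≤ with p v ℕ.≟ s
            ... | yes refl = [ (λ v∈ → inj₁ (ext g₂ v∈)) , inj₂ ]′ (keep-s v∈J refl)
            ... | no ne = [ (λ v∈ → inj₁ (X⊆X₂ v∈)) , (λ d → inj₂ (λ i → d (down₂ (▹-mono (atLeast-⊆ X⊆X₂)) i))) ]′
                            (X.keep v∈J (ℕₚ.≤∧≢⇒< s≤ (λ e → ne (sym e))))
            free′ : ∀ {u W} → s ≤ u → Indep I₁ W → (∀ {v} → v ∈ W → p v < u) → Indep I₁ (W ∪ level p X₂ u)
            free′ {u} {W} s≤u iW lo with s ℕ.≟ u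
            ... | yes refl = free₁ (inv g₂) iW lo
            ... | no ne = down₁ (∪-monoʳ {C = W} above) (X.free₁ (ℕₚ.≤∧≢⇒< s≤u ne) iW lo)
              where
              above : level p X₂ u ⊆ level p X u
              above v∈ with ∈-level⁻ p X₂ v∈
              ... | v∈X₂ , e with from (inv g₂) v∈X₂
              ... | inj₁ v∈X = ∈-level⁺ p X v∈X e
              ... | inj₂ (_ , e′) = contradiction (trans (sym e′) e) ne
            full′ : ∀ {v} → s ≤ p v → p v < K →
                    ¬ Indep I₂ (atLeast p X₂ (p v) ▹ v) ⊎ M₁.Span (B (p v) ∪ level p X₂ (p v)) v
            full′ {v} s≤ <K with p v ℕ.≟ s
            ... | no ne with X.full (ℕₚ.≤∧≢⇒< s≤ (λ e → ne (sym e))) <K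
            ... | inj₁ d = inj₁ (λ i → d (down₂ (▹-mono (atLeast-⊆ X⊆X₂)) i))
            ... | inj₂ sp = inj₂ (M₁.span-mono (∪-monoʳ {C = B (p v)} (level-⊆ X⊆X₂)) sp)
            full′ {v} s≤ <K | yes refl with v ∈? J
            ... | yes v∈J with keep-s v∈J refl
            ... | inj₁ v∈X₁ = inj₂ (inj₁ (Subₚ.x∈p∪q⁺ (inj₂ (∈-level⁺ p X₂ (ext g₂ v∈X₁) refl))))
            ... | inj₂ d = inj₁ d
            full′ {v} s≤ <K | yes refl | no v∉J
              with maximal g₂ (∈-elems⁺ (∈-level⁺ p (∁ J) (Subₚ.x∉p⇒x∈∁p v∉J) refl))
            ... | inj₁ v∈X₂ = inj₂ (inj₁ (Subₚ.x∈p∪q⁺ (inj₂ (∈-level⁺ p X₂ v∈X₂ refl))))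
            ... | inj₂ (Y , par , Y⊆ , inj₁ d) = inj₁ (λ i → d (down₂ (▹-mono (⊆atLeast par Y⊆)) i))
            ... | inj₂ (Y , par , Y⊆ , inj₂ d) = inj₂ (M₁.span-mono (∪-monoʳ {C = B (p v)} (level-⊆ Y⊆)) (inj₂ d))

          partial-⊤ : ∀ {Y} → Partial J Y → Partial ⊤ Y
          partial-⊤ par = record { ext = ext ; indep₂ = indep₂ ; free₁ = free₁
            ; from = λ v∈ → [ inj₁ , (λ (_ , e) → inj₂ (Subₚ.∈⊤ , e)) ]′ (from v∈) }
            where open Partial par

        run-assign : ∀ k s → s + k ≡ K → Run O (assign p B J k s) (2 *ℕ ∣ atLeast p ⊤ s ∣) (Assigned s)
        run-assign zero s refl = run-ret record
          { indep₂ = M₂.indep-⊥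
          ; range = λ v∈ → contradiction v∈ Subₚ.∉⊥
          ; keep = λ v∈J s≤ → contradiction (Inv.<K invJ v∈J) (ℕₚ.≤⇒≯ (ℕₚ.≤-trans (ℕₚ.≤-reflexive (ℕₚ.+-identityʳ s)) s≤))
          ; free₁ = λ _ iW _ → down₁ (∪-⊥ˡ (λ v∈ → Subₚ.∉⊥ (proj₁ (∈-level⁻ p ⊥ v∈)))) iW
          ; full = λ s≤ lt → contradiction lt (ℕₚ.≤⇒≯ (ℕₚ.≤-trans (ℕₚ.≤-reflexive (ℕₚ.+-identityʳ s)) s≤)) }
        run-assign (suc k) s eq = run-≤ bound (run-bind (run-assign k (suc s) (trans (sym (ℕₚ.+-suc s k)) eq)) λ X asX →
          run-bind (run-grow (run-bid s<K asX) (Partial s<K asX J) (elems (level p J s))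
                     (λ v∈ → let (v∈J , e) = ∈-level⁻ p J (∈-elems⁻ v∈) in partial-step s<K asX v∈J e)
                     (partial-⊥ s<K asX)) λ X₁ g₁ →
          run-weaken ℕₚ.≤-refl (λ X₂ g₂ → assigned-step s<K asX g₁ g₂)
            (run-grow (run-bid s<K asX) (Partial s<K asX ⊤) (elems (level p (∁ J) s))
              (λ v∈ → let (_ , e) = ∈-level⁻ p (∁ J) (∈-elems⁻ v∈) in partial-step s<K asX Subₚ.∈⊤ e)
              (partial-⊤ s<K asX (Grown.inv g₁))))
          where
          s<K : s < K
          s<K = subst (s <_) eq (ℕₚ.m<m+n s z<s)
          a b c d : ℕ
          a = ∣ atLeast p ⊤ (suc s) ∣
          b = ∣ level p J s ∣
          c = ∣ level p (∁ J) s ∣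
          d = ∣ level p ⊤ s ∣
          bc≤d : b + c ≤ d
          bc≤d = ∣disjoint∣≤ {X = level p J s} {level p (∁ J) s} {level p ⊤ s}
            (λ v∈ → ∈-level⁺ p ⊤ Subₚ.∈⊤ (proj₂ (∈-level⁻ p J v∈)))
            (λ v∈ → ∈-level⁺ p ⊤ Subₚ.∈⊤ (proj₂ (∈-level⁻ p (∁ J) v∈)))
            (λ v∈ v∈′ → Subₚ.x∈∁p⇒x∉p (proj₁ (∈-level⁻ p (∁ J) v∈′)) (proj₁ (∈-level⁻ p J v∈)))
          ad≤ : a + d ≤ ∣ atLeast p ⊤ s ∣
          ad≤ = ∣disjoint∣≤ {X = atLeast p ⊤ (suc s)} {level p ⊤ s} {atLeast p ⊤ s}
            (λ v∈ → ∈-atLeast⁺ p ⊤ Subₚ.∈⊤ (ℕₚ.<⇒≤ (proj₂ (∈-atLeast⁻ p ⊤ v∈))))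
            (λ v∈ → ∈-atLeast⁺ p ⊤ Subₚ.∈⊤ (ℕₚ.≤-reflexive (sym (proj₂ (∈-level⁻ p ⊤ v∈)))))
            (λ v∈ v∈′ → ℕₚ.<-irrefl (sym (proj₂ (∈-level⁻ p ⊤ v∈′))) (proj₂ (∈-atLeast⁻ p ⊤ v∈)))
          open ℕₚ.≤-Reasoning
          bound : 2 *ℕ a + (length (elems (level p J s)) *ℕ 2 + length (elems (level p (∁ J) s)) *ℕ 2)
                  ≤ 2 *ℕ ∣ atLeast p ⊤ s ∣
          bound = begin
            2 *ℕ a + (length (elems (level p J s)) *ℕ 2 + length (elems (level p (∁ J) s)) *ℕ 2)
              ≡⟨ cong (2 *ℕ a +_) (cong₂ (λ x y → x *ℕ 2 + y *ℕ 2) (length-elems (level p J s)) (length-elems (level p (∁ J) s))) ⟩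
            2 *ℕ a + (b *ℕ 2 + c *ℕ 2)
              ≡⟨ cong (2 *ℕ a +_) (trans (sym (ℕₚ.*-distribʳ-+ 2 b c)) (ℕₚ.*-comm (b + c) 2)) ⟩
            2 *ℕ a + 2 *ℕ (b + c)  ≡⟨ sym (ℕₚ.*-distribˡ-+ 2 a (b + c)) ⟩
            2 *ℕ (a + (b + c))     ≤⟨ ℕₚ.*-monoʳ-≤ 2 (ℕₚ.≤-trans (ℕₚ.+-monoʳ-≤ a bc≤d) ad≤) ⟩
            2 *ℕ ∣ atLeast p ⊤ s ∣ ∎

        -- Auction: duality and potential of one round

        module _ {J′ : Subset n} (as : Assigned 0 J′) where
          open Assigned as

          -- An incumbent is kept or displaced by elements at least as expensive; hence the part of
          -- `J′` priced from `t` on spans the corresponding part of `J`, and with it all that this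
          -- part spanned.
          transfer : ∀ {v t} → p v ≡ suc t → M₂.Span (atLeast p J′ t) v
          transfer {v} {t} e = M₂.span-trans (down₂ (λ u∈ → proj₁ (∈-atLeast⁻ p J u∈)) (proj₂ (Inv.common invJ)))
            kept (Inv.priced invJ e)
            where
            kept : ∀ {u} → u ∈ atLeast p J t → M₂.Span (atLeast p J′ t) u
            kept {u} u∈ with ∈-atLeast⁻ p J u∈
            ... | u∈J , t≤ with keep u∈J z≤n
            ... | inj₁ u∈J′ = inj₁ (∈-atLeast⁺ p J′ u∈J′ t≤)
            ... | inj₂ d = inj₂ (λ i → d (down₂ (▹-mono higher) i))
              where
              higher : atLeast p J′ (p u) ⊆ atLeast p J′ t
              higher w∈ = let (w∈J′ , le) = ∈-atLeast⁻ p J′ w∈ in ∈-atLeast⁺ p J′ w∈J′ (ℕₚ.≤-trans t≤ le)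

          -- Every level is free over all cheaper elements, so although `J′` was built from the top,
          -- its levels can be stacked from the bottom.
          indep₁ : Indep I₁ J′
          indep₁ = down₁ (λ v∈ → ∈-below⁺ p J′ v∈ (proj₂ (range v∈))) (go K)
            where
            go : ∀ u → Indep I₁ (below p J′ u)
            go zero = down₁ (λ v∈ → contradiction (proj₂ (∈-below⁻ p J′ v∈)) ℕₚ.n≮0) M₁.indep-⊥
            go (suc u) = down₁ split (free₁ z≤n (go u) (λ v∈ → proj₂ (∈-below⁻ p J′ v∈)))
              where
              split : below p J′ (suc u) ⊆ below p J′ u ∪ level p J′ u
              split {v} v∈ with ∈-below⁻ p J′ v∈ | p v ℕ.≟ u
              ... | v∈J′ , _ | yes e = Subₚ.x∈p∪q⁺ (inj₂ (∈-level⁺ p J′ v∈J′ e))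
              ... | v∈J′ , lt | no ne = Subₚ.x∈p∪q⁺ (inj₁ (∈-below⁺ p J′ v∈J′ (ℕₚ.≤∧≢⇒< (ℕₚ.≤-pred lt) ne)))

          -- Level `u` of `J′` is independent over `B u`, so passing to the next threshold raises
          -- the M₁-rank by at least its size. Iterating up to `K` collects all levels from `u` on.
          ∣B∣+∣J′∣≤ : ∀ k {u} → u + k ≡ K → ∣ B u ∣ + ∣ atLeast p J′ u ∣ ≤ ∣ B K ∣
          ∣B∣+∣J′∣≤ zero {u} eq with trans (sym (ℕₚ.+-identityʳ u)) eq
          ... | refl = ℕₚ.≤-reflexive (trans (cong (∣ B u ∣ +_) none) (ℕₚ.+-identityʳ _))
            where
            none : ∣ atLeast p J′ u ∣ ≡ 0
            none = ℕₚ.n≤0⇒n≡0 (ℕₚ.≤-trans (Subₚ.p⊆q⇒∣p∣≤∣q∣ {p = atLeast p J′ u} {⊥}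
              (λ v∈ → let (v∈J′ , le) = ∈-atLeast⁻ p J′ v∈ in contradiction le (ℕₚ.<⇒≱ (proj₂ (range v∈J′)))))
              (ℕₚ.≤-reflexive (Subₚ.∣⊥∣≡0 n)))
          ∣B∣+∣J′∣≤ (suc k) {u} eq = begin
            ∣ B u ∣ + ∣ atLeast p J′ u ∣
              ≤⟨ ℕₚ.+-monoʳ-≤ ∣ B u ∣ (∣cover∣≤ {X = level p J′ u} {atLeast p J′ (suc u)} split) ⟩
            ∣ B u ∣ + (∣ level p J′ u ∣ + ∣ atLeast p J′ (suc u) ∣)  ≡⟨ sym (ℕₚ.+-assoc ∣ B u ∣ _ _) ⟩
            ∣ B u ∣ + ∣ level p J′ u ∣ + ∣ atLeast p J′ (suc u) ∣
              ≤⟨ ℕₚ.+-monoˡ-≤ _ (ℕₚ.≤-trans disjoint next) ⟩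
            ∣ B (suc u) ∣ + ∣ atLeast p J′ (suc u) ∣  ≤⟨ ∣B∣+∣J′∣≤ k (trans (sym (ℕₚ.+-suc u k)) eq) ⟩
            ∣ B K ∣ ∎
            where
            open ℕₚ.≤-Reasoning
            u<K : u < K
            u<K = subst (u <_) eq (ℕₚ.m<m+n u z<s)
            split : ∀ {v} → v ∈ atLeast p J′ u → v ∈ level p J′ u ⊎ v ∈ atLeast p J′ (suc u)
            split {v} v∈ with ∈-atLeast⁻ p J′ v∈ | p v ℕ.≟ u
            ... | v∈J′ , _ | yes e = inj₁ (∈-level⁺ p J′ v∈J′ e)
            ... | v∈J′ , le | no ne = inj₂ (∈-atLeast⁺ p J′ v∈J′ (ℕₚ.≤∧≢⇒< le (λ e → ne (sym e))))
            disjoint : ∣ B u ∣ + ∣ level p J′ u ∣ ≤ ∣ B u ∪ level p J′ u ∣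
            disjoint = ∣disjoint∣≤ {X = B u} {level p J′ u} {B u ∪ level p J′ u}
              (λ v∈ → Subₚ.x∈p∪q⁺ (inj₁ v∈)) (λ v∈ → Subₚ.x∈p∪q⁺ (inj₂ v∈))
              (λ v∈B v∈L → ℕₚ.<-irrefl (proj₂ (∈-level⁻ p J′ v∈L)) (Basis.lower (isB u (ℕₚ.<⇒≤ u<K)) v∈B))
            next : ∣ B u ∪ level p J′ u ∣ ≤ ∣ B (suc u) ∣
            next = M₁.spanned-≤ (Basis.indep (isB (suc u) u<K))
              (free₁ z≤n (Basis.indep (isB u (ℕₚ.<⇒≤ u<K))) (Basis.lower (isB u (ℕₚ.<⇒≤ u<K))))
              (λ v∈ → Basis.spans (isB (suc u) u<K) ([ (λ v∈B → ℕₚ.m<n⇒m<1+n (Basis.lower (isB u (ℕₚ.<⇒≤ u<K)) v∈B))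
                 , (λ v∈L → s≤s (ℕₚ.≤-reflexive (proj₂ (∈-level⁻ p J′ v∈L)))) ]′ (Subₚ.x∈p∪q⁻ (B u) _ v∈)))

          deficit : ℕ
          deficit = ∣ B K ∣ ∸ ∣ J′ ∣

          ∣B∣≡ : ∣ B K ∣ ≡ ∣ J′ ∣ + deficit
          ∣B∣≡ = sym (ℕₚ.m+[n∸m]≡n (ℕₚ.≤-trans
            (Subₚ.p⊆q⇒∣p∣≤∣q∣ {p = J′} {atLeast p J′ 0} (λ v∈ → ∈-atLeast⁺ p J′ v∈ z≤n))
            (ℕₚ.≤-trans (ℕₚ.m≤n+m _ ∣ B 0 ∣) (∣B∣+∣J′∣≤ K {0} refl))))

          -- Weak duality at the threshold t, for every t < K; the surplus terms add up to at most ∣ J′ ∣.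
          ∣T∣≤ : ∀ {T} → CommonIndep I₁ I₂ T → ∀ t → t < K → ∣ T ∣ ≤ ∣ level p J′ t ∣ + ∣ B K ∣
          ∣T∣≤ {T} (iT₁ , iT₂) t t<K = begin
            ∣ T ∣ ≤⟨ ∣cover∣≤ {X = below p T (suc t)} {atLeast p T (suc t)} split ⟩
            ∣ below p T (suc t) ∣ + ∣ atLeast p T (suc t) ∣ ≤⟨ ℕₚ.+-mono-≤ low high ⟩
            ∣ B (suc t) ∣ + ∣ atLeast p J′ t ∣ ≤⟨ ℕₚ.+-monoʳ-≤ ∣ B (suc t) ∣ (∣cover∣≤ {X = level p J′ t} {atLeast p J′ (suc t)} split′) ⟩
            ∣ B (suc t) ∣ + (∣ level p J′ t ∣ + ∣ atLeast p J′ (suc t) ∣) ≡⟨ x∙yz≈y∙xz (∣ B (suc t) ∣) (∣ level p J′ t ∣) (∣ atLeast p J′ (suc t) ∣) ⟩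
            ∣ level p J′ t ∣ + (∣ B (suc t) ∣ + ∣ atLeast p J′ (suc t) ∣)
              ≤⟨ ℕₚ.+-monoʳ-≤ ∣ level p J′ t ∣ (∣B∣+∣J′∣≤ (K ∸ suc t) (ℕₚ.m+[n∸m]≡n t<K)) ⟩
            ∣ level p J′ t ∣ + ∣ B K ∣ ∎
            where
            open ℕₚ.≤-Reasoning
            open import Algebra.Properties.CommutativeSemigroup ℕₚ.+-commutativeSemigroup using (x∙yz≈y∙xz)
            split : ∀ {v} → v ∈ T → v ∈ below p T (suc t) ⊎ v ∈ atLeast p T (suc t)
            split {v} v∈ with p v <? suc t
            ... | yes lt = inj₁ (∈-below⁺ p T v∈ lt)
            ... | no ge = inj₂ (∈-atLeast⁺ p T v∈ (ℕₚ.≮⇒≥ ge))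
            split′ : ∀ {v} → v ∈ atLeast p J′ t → v ∈ level p J′ t ⊎ v ∈ atLeast p J′ (suc t)
            split′ {v} v∈ with ∈-atLeast⁻ p J′ v∈ | p v ℕ.≟ t
            ... | v∈J′ , _ | yes e = inj₁ (∈-level⁺ p J′ v∈J′ e)
            ... | v∈J′ , le | no ne = inj₂ (∈-atLeast⁺ p J′ v∈J′ (ℕₚ.≤∧≢⇒< le (λ e → ne (sym e))))
            low : ∣ below p T (suc t) ∣ ≤ ∣ B (suc t) ∣
            low = M₁.spanned-≤ (Basis.indep (isB (suc t) t<K)) (down₁ (λ v∈ → proj₁ (∈-below⁻ p T v∈)) iT₁)
              (λ v∈ → Basis.spans (isB (suc t) t<K) (proj₂ (∈-below⁻ p T v∈)))
            high : ∣ atLeast p T (suc t) ∣ ≤ ∣ atLeast p J′ t ∣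
            high = M₂.spanned-≤ (down₂ (λ v∈ → proj₁ (∈-atLeast⁻ p J′ v∈)) indep₂)
              (down₂ (λ v∈ → proj₁ (∈-atLeast⁻ p T v∈)) iT₂) spanned
              where
              spanned : ∀ {v} → v ∈ atLeast p T (suc t) → M₂.Span (atLeast p J′ t) v
              -- A price of at least t + 1 has the form w + 1 with w at least t, and `transfer`
              -- spans `v` one unit below its price: this is the shift between the two thresholds.
              spanned {v} v∈ with p v in e | proj₂ (∈-atLeast⁻ p T v∈)
              ... | suc w | s≤s t≤w = M₂.span-mono
                (λ u∈ → let (u∈J′ , le) = ∈-atLeast⁻ p J′ u∈ in ∈-atLeast⁺ p J′ u∈J′ (ℕₚ.≤-trans t≤w le)) (transfer e)

          round-dual : ∀ {T} → CommonIndep I₁ I₂ T → K *ℕ ∣ T ∣ ≤ suc K *ℕ ∣ J′ ∣ + K *ℕ deficit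
          round-dual {T} cT = begin
            K *ℕ ∣ T ∣ ≡⟨ sym (Σ<-const K ∣ T ∣) ⟩
            Σ< K (λ _ → ∣ T ∣) ≤⟨ Σ<-mono K (∣T∣≤ cT) ⟩
            Σ< K (λ t → ∣ level p J′ t ∣ + ∣ B K ∣) ≡⟨ Σ<-+ K _ _ ⟩
            Σ< K (λ t → ∣ level p J′ t ∣) + Σ< K (λ _ → ∣ B K ∣)
              ≤⟨ ℕₚ.+-mono-≤ (Σ-level≤ p J′ K) (ℕₚ.≤-reflexive (Σ<-const K ∣ B K ∣)) ⟩
            ∣ J′ ∣ + K *ℕ ∣ B K ∣ ≡⟨ cong (λ x → ∣ J′ ∣ + K *ℕ x) ∣B∣≡ ⟩
            ∣ J′ ∣ + K *ℕ (∣ J′ ∣ + deficit) ≡⟨ cong (∣ J′ ∣ +_) (ℕₚ.*-distribˡ-+ K ∣ J′ ∣ deficit) ⟩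
            ∣ J′ ∣ + (K *ℕ ∣ J′ ∣ + K *ℕ deficit) ≡⟨ sym (ℕₚ.+-assoc ∣ J′ ∣ _ _) ⟩
            suc K *ℕ ∣ J′ ∣ + K *ℕ deficit ∎
            where open ℕₚ.≤-Reasoning

          record Outbid (R : Subset n) : Set where
            field
              sound    : ∀ {v} → v ∈ R → v ∉ J′ × ¬ Indep I₂ (atLeast p J′ (p v) ▹ v)
              complete : ∀ {v} → v ∉ J′ → p v < K → ¬ Indep I₂ (atLeast p J′ (p v) ▹ v) → v ∈ R

          module _ {R : Subset n} (out : Outbid R) where
            open Outbid out
            private
              p′ : Fin n → ℕ
              p′ = raise p R

            raise-≥ : ∀ v → p v ≤ p′ v
            raise-≥ v = if-elim (p v ≤_) (v ∈? R) (λ _ → ℕₚ.n≤1+n _) (λ _ → ℕₚ.≤-refl)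

            raise-∈ : ∀ {v} → v ∈ R → p′ v ≡ suc (p v)
            raise-∈ {v} v∈ = if-elim (_≡ suc (p v)) (v ∈? R) (λ _ → refl) (λ v∉ → contradiction v∈ v∉)

            raise-∉ : ∀ {v} → v ∉ R → p′ v ≡ p v
            raise-∉ {v} v∉ = if-elim (_≡ p v) (v ∈? R) (λ v∈ → contradiction v∈ v∉) (λ _ → refl)

            raise-J′ : ∀ {v} → v ∈ J′ → p′ v ≡ p v
            raise-J′ v∈ = raise-∉ (λ v∈R → proj₁ (sound v∈R) v∈)

            -- Elements of `J′` keep their prices, and an element that has just become dearer is
            -- spanned by those that rejected it at its former price.
            round-inv : Inv p′ J′
            round-inv = record
              { common = indep₁ , indep₂
              ; <K = λ v∈ → subst (_< K) (sym (raise-J′ v∈)) (proj₂ (range v∈))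
              ; priced = λ e → M₂.span-mono up (priced′ e)
              ; free₁ = λ u {W} iW lo → down₁ (∪-monoʳ {C = W} same-level) (free₁ z≤n iW (λ {v} v∈ → ℕₚ.≤-<-trans (raise-≥ v) (lo v∈))) }
              where
              up : ∀ {t} → atLeast p J′ t ⊆ atLeast p′ J′ t
              up {t} {v} v∈ = let (v∈J′ , le) = ∈-atLeast⁻ p J′ v∈ in ∈-atLeast⁺ p′ J′ v∈J′ (ℕₚ.≤-trans le (raise-≥ v))
              same-level : ∀ {u} → level p′ J′ u ⊆ level p J′ u
              same-level v∈ = let (v∈J′ , e) = ∈-level⁻ p′ J′ v∈ in ∈-level⁺ p J′ v∈J′ (trans (sym (raise-J′ v∈J′)) e)
              priced′ : ∀ {v t} → p′ v ≡ suc t → M₂.Span (atLeast p J′ t) v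
              priced′ {v} {t} e = by-cases (v ∈? R)
                where
                by-cases : Dec (v ∈ R) → M₂.Span (atLeast p J′ t) v
                by-cases (no v∉R) = transfer (trans (sym (raise-∉ v∉R)) e)
                by-cases (yes v∈R) = subst (λ s → M₂.Span (atLeast p J′ s) v)
                  (ℕₚ.suc-injective (trans (sym (raise-∈ v∈R)) e)) (inj₂ (proj₂ (sound v∈R)))

            -- `B t` with level `t` of `J′` spans all elements of new price at most t: one of old
            -- price t outside `J′` that was not raised was not rejected by M₂, so `full` applies.
            -- Summation replaces each |B (t + 1)| by |B t| plus a level, which trades |B K| for
            -- |J′| and so loses exactly the deficit.
            round-potential : ∀ {q} → Potential≤ p q → ∃[ q′ ] (q′ + deficit ≤ q × Potential≤ p′ q′)
            round-potential {q} pot = Σ< K (λ t → ∣ B t ∣) + ∣ J′ ∣ , less , pot′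
              where
              open ℕₚ.≤-Reasoning
              B₀ : ∣ B 0 ∣ ≡ 0
              B₀ = ℕₚ.n≤0⇒n≡0 (ℕₚ.≤-trans (Subₚ.p⊆q⇒∣p∣≤∣q∣ {p = B 0} {⊥}
                (λ v∈ → contradiction (Basis.lower (isB 0 z≤n) v∈) ℕₚ.n≮0)) (ℕₚ.≤-reflexive (Subₚ.∣⊥∣≡0 n)))
              less : Σ< K (λ t → ∣ B t ∣) + ∣ J′ ∣ + deficit ≤ q
              less = begin
                Σ< K (λ t → ∣ B t ∣) + ∣ J′ ∣ + deficit ≡⟨ ℕₚ.+-assoc (Σ< K (λ t → ∣ B t ∣)) _ _ ⟩
                Σ< K (λ t → ∣ B t ∣) + (∣ J′ ∣ + deficit) ≡⟨ cong (Σ< K (λ t → ∣ B t ∣) +_) (sym ∣B∣≡) ⟩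
                Σ< K (λ t → ∣ B t ∣) + ∣ B K ∣ ≡⟨ sym (Σ<-shift K (λ t → ∣ B t ∣)) ⟩
                Σ< K (λ t → ∣ B (suc t) ∣) + ∣ B 0 ∣ ≡⟨ trans (cong (Σ< K (λ t → ∣ B (suc t) ∣) +_) B₀) (ℕₚ.+-identityʳ _) ⟩
                Σ< K (λ t → ∣ B (suc t) ∣)
                  ≤⟨ pot B (λ t≤ → Basis.indep (isB _ t≤)) (λ t≤ → Basis.lower (isB _ t≤)) ⟩
                q ∎
              pot′ : Potential≤ p′ (Σ< K (λ t → ∣ B t ∣) + ∣ J′ ∣)
              pot′ W iW lo = begin
                Σ< K (λ t → ∣ W (suc t) ∣) ≤⟨ Σ<-mono K each ⟩
                Σ< K (λ t → ∣ B t ∣ + ∣ level p J′ t ∣) ≡⟨ Σ<-+ K _ _ ⟩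
                Σ< K (λ t → ∣ B t ∣) + Σ< K (λ t → ∣ level p J′ t ∣) ≤⟨ ℕₚ.+-monoʳ-≤ _ (Σ-level≤ p J′ K) ⟩
                Σ< K (λ t → ∣ B t ∣) + ∣ J′ ∣ ∎
                where
                each : ∀ t → t < K → ∣ W (suc t) ∣ ≤ ∣ B t ∣ + ∣ level p J′ t ∣
                each t t<K = ℕₚ.≤-trans (M₁.spanned-≤
                  (free₁ z≤n (Basis.indep (isB t (ℕₚ.<⇒≤ t<K))) (Basis.lower (isB t (ℕₚ.<⇒≤ t<K))))
                  (iW t<K) (λ v∈ → spanned (lo t<K v∈))) (∣∪∣≤ (B t) _)
                  where
                  spanned : ∀ {v} → p′ v < suc t → M₁.Span (B t ∪ level p J′ t) v
                  spanned {v} lt with p v ℕ.≟ t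
                  ... | no ne = M₁.span-mono (λ u∈ → Subₚ.x∈p∪q⁺ (inj₁ u∈))
                    (Basis.spans (isB t (ℕₚ.<⇒≤ t<K)) (ℕₚ.≤∧≢⇒< (ℕₚ.≤-trans (raise-≥ v) (ℕₚ.≤-pred lt)) ne))
                  ... | yes refl with v ∈? J′
                  ... | yes v∈J′ = inj₁ (Subₚ.x∈p∪q⁺ (inj₂ (∈-level⁺ p J′ v∈J′ refl)))
                  ... | no v∉J′ with full z≤n t<K
                  ... | inj₂ sp = sp
                  ... | inj₁ d = contradiction (subst (_< suc (p v)) (raise-∈ (complete v∉J′ t<K d)) lt) (ℕₚ.<-irrefl refl)

    -- Auction: iterating the rounds

    record Round (p : Fin n → ℕ) (result : Subset n × Subset n × ℕ) : Set where
      private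
        J′ = proj₁ result
        p′ = raise p (proj₁ (proj₂ result))
        a  = proj₂ (proj₂ result)
      field
        inv′      : Inv p′ J′
        dual      : ∀ {T} → CommonIndep I₁ I₂ T → K *ℕ ∣ T ∣ ≤ suc K *ℕ ∣ J′ ∣ + K *ℕ a
        potential : ∀ {q} → Potential≤ p q → ∃[ q′ ] (q′ + a ≤ q × Potential≤ p′ q′)

    run-round : ∀ {p J} → Inv p J → Run O (round p J) (4 *ℕ n) (Round p)
    run-round {p} {J} invJ = run-≤ bound
      (run-bind (run-bases p K) λ B isB →
       run-bind (run-assign p B isB invJ K 0 refl) λ J′ as →
       run-bind (run-≤ (length-elems≤ (below p (∁ J′) K)) (run-grow (λ v _ → run-outbid J′ v) (InvR J′) (elems (below p (∁ J′) K)) (stepR J′)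
                   (λ v∈ → contradiction v∈ Subₚ.∉⊥))) λ R g →
       run-ret {c = 0} (finish B isB as (outbid-spec B isB as g)))
      where
      Outcome : Subset n → Fin n → Bool → Set
      Outcome J′ v b = I₂ (atLeast p J′ (p v) ▹ v) ≡ not b
      run-outbid : ∀ J′ v → Run O (outbid p J′ v) 1 (Outcome J′ v)
      run-outbid J′ v = run-bind (run-ask true (atLeast p J′ (p v) ▹ v))
        λ b e → run-ret (trans e (sym (Boolₚ.not-involutive b)))
      InvR : Subset n → Subset n → Set
      InvR J′ R = ∀ {v} → v ∈ R → v ∉ J′ × ¬ Indep I₂ (atLeast p J′ (p v) ▹ v)
      stepR : ∀ J′ {v R} → v ∈ₗ elems (below p (∁ J′) K) → InvR J′ R → Outcome J′ v true → InvR J′ (R ▹ v)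
      stepR J′ v∈ iR d u∈ with ▹⁻ u∈
      ... | inj₁ u∈R = iR u∈R
      ... | inj₂ refl = Subₚ.x∈∁p⇒x∉p (proj₁ (∈-below⁻ p (∁ J′) (∈-elems⁻ v∈))) , dependent {I = I₂} d
      outbid-spec : ∀ B {J′ R} (isB : ∀ u → u ≤ K → Basis p u (B u)) (as : Assigned p B isB invJ 0 J′) →
                    Grown (λ v _ → run-outbid J′ v) (InvR J′) (elems (below p (∁ J′) K)) ⊥ R → Outbid p B isB invJ as R
      outbid-spec B {J′} isB as g = record
        { sound = λ v∈ → Grown.inv g v∈
        ; complete = λ v∉J′ v<K d →
            [ (λ v∈R → v∈R) , (λ (_ , _ , _ , i) → contradiction i d) ]′
              (Grown.maximal g (∈-elems⁺ (∈-below⁺ p (∁ J′) (Subₚ.x∉p⇒x∈∁p v∉J′) v<K))) }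
      finish : ∀ B {J′ R} (isB : ∀ u → u ≤ K → Basis p u (B u)) (as : Assigned p B isB invJ 0 J′) →
               Outbid p B isB invJ as R → Round p (J′ , R , ∣ B K ∣ ∸ ∣ J′ ∣)
      finish B isB as out = record
        { inv′ = round-inv p B isB invJ as out ; dual = round-dual p B isB invJ as
        ; potential = round-potential p B isB invJ as out }
      bound : Σ< K (λ t → ∣ level p ⊤ t ∣) + (2 *ℕ ∣ atLeast p ⊤ 0 ∣ + (n + 0)) ≤ 4 *ℕ n
      bound = begin
        Σ< K (λ t → ∣ level p ⊤ t ∣) + (2 *ℕ ∣ atLeast p ⊤ 0 ∣ + (n + 0))
          ≤⟨ ℕₚ.+-mono-≤ (ℕₚ.≤-trans (Σ-level≤ p ⊤ K) (Subₚ.∣p∣≤n {n} ⊤))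
               (ℕₚ.+-mono-≤ (ℕₚ.*-monoʳ-≤ 2 (Subₚ.∣p∣≤n (atLeast p ⊤ 0))) (ℕₚ.≤-reflexive (ℕₚ.+-identityʳ n))) ⟩
        n + (2 *ℕ n + n) ≡⟨ cong (n +_) (ℕₚ.+-comm (2 *ℕ n) n) ⟩
        n + (n + 2 *ℕ n) ≡⟨⟩
        4 *ℕ n ∎
        where open ℕₚ.≤-Reasoning

    -- A round that does not halt has |J′| < K a, so duality gives |T| ≤ (2 + K) a. The potential
    -- times 2 + K therefore falls by at least |T| per round, just as the right side of the fuel
    -- condition does; with no fuel left that condition is absurd.
    run-auction : ∀ f {p J q} → Inv p J → Potential≤ p q →
      Run O (auction f p J) (f *ℕ (4 *ℕ n)) (λ J′ → CommonIndep I₁ I₂ J′ ×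
        (∀ {T} → CommonIndep I₁ I₂ T → q *ℕ (2 + K) < f *ℕ ∣ T ∣ → K *ℕ ∣ T ∣ ≤ (2 + K) *ℕ ∣ J′ ∣))
    run-auction zero invJ pot = run-ret (Inv.common invJ , λ _ ())
    run-auction (suc f) {p} {J} {q} invJ pot = run-bind (run-round invJ) next
      where
      Near′ : ℕ → ℕ → Subset n → Set
      Near′ f q J′ = CommonIndep I₁ I₂ J′ ×
        (∀ {T} → CommonIndep I₁ I₂ T → q *ℕ (2 + K) < f *ℕ ∣ T ∣ → K *ℕ ∣ T ∣ ≤ (2 + K) *ℕ ∣ J′ ∣)
      next : ∀ ((J′ , R , a) : Subset n × Subset n × ℕ) → Round p (J′ , R , a) →
             Run O (if does (K *ℕ a ≤? ∣ J′ ∣) then ret J′ else auction f (raise p R) J′) (f *ℕ (4 *ℕ n)) (Near′ (suc f) q)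
      next (J′ , R , a) rd = if-elim (λ m → Run O m (f *ℕ (4 *ℕ n)) (Near′ (suc f) q)) (K *ℕ a ≤? ∣ J′ ∣) halt proceed
        where
        open Round rd
        open ℕₚ.≤-Reasoning
        halt : K *ℕ a ≤ ∣ J′ ∣ → Run O (ret J′) (f *ℕ (4 *ℕ n)) (Near′ (suc f) q)
        halt small = run-ret (Inv.common inv′ , λ {T} cT _ → begin
          K *ℕ ∣ T ∣ ≤⟨ dual cT ⟩
          suc K *ℕ ∣ J′ ∣ + K *ℕ a ≤⟨ ℕₚ.+-monoʳ-≤ (suc K *ℕ ∣ J′ ∣) small ⟩
          suc K *ℕ ∣ J′ ∣ + ∣ J′ ∣ ≡⟨ ℕₚ.+-comm (suc K *ℕ ∣ J′ ∣) ∣ J′ ∣ ⟩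
          (2 + K) *ℕ ∣ J′ ∣ ∎)
        proceed : ¬ (K *ℕ a ≤ ∣ J′ ∣) → Run O (auction f (raise p R) J′) (f *ℕ (4 *ℕ n)) (Near′ (suc f) q)
        proceed large with potential pot
        ... | q′ , q′+a≤q , pot′ = run-weaken ℕₚ.≤-refl
          (λ _ (c , near) → c , λ cT lt → near cT (fuel cT lt)) (run-auction f inv′ pot′)
          where
          ∣T∣≤a : ∀ {T} → CommonIndep I₁ I₂ T → ∣ T ∣ ≤ (2 + K) *ℕ a
          ∣T∣≤a {T} cT = cancel K (ℕₚ.≰⇒> large) (begin
            K *ℕ ∣ T ∣ ≤⟨ dual cT ⟩
            suc K *ℕ ∣ J′ ∣ + K *ℕ a ≤⟨ ℕₚ.+-monoˡ-≤ (K *ℕ a) (ℕₚ.*-monoʳ-≤ (suc K) (ℕₚ.<⇒≤ (ℕₚ.≰⇒> large))) ⟩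
            suc K *ℕ (K *ℕ a) + K *ℕ a ≡⟨ ℕₚ.+-comm (suc K *ℕ (K *ℕ a)) (K *ℕ a) ⟩
            (2 + K) *ℕ (K *ℕ a) ≡⟨ x∙yz≈y∙xz (2 + K) K a ⟩
            K *ℕ ((2 + K) *ℕ a) ∎)
            where
            open import Algebra.Properties.CommutativeSemigroup ℕₚ.*-commutativeSemigroup using (x∙yz≈y∙xz)
            -- The failed halting test also supplies that K is positive, since nothing is smaller
            -- than 0 · a.
            cancel : ∀ k {x y j} → j < k *ℕ a → k *ℕ x ≤ k *ℕ y → x ≤ y
            cancel (suc k) _ = ℕₚ.*-cancelˡ-≤ (suc k)
          fuel : ∀ {T} → CommonIndep I₁ I₂ T → q *ℕ (2 + K) < suc f *ℕ ∣ T ∣ → q′ *ℕ (2 + K) < f *ℕ ∣ T ∣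
          fuel {T} cT lt = ℕₚ.+-cancelˡ-< ∣ T ∣ _ _ (begin-strict
            ∣ T ∣ + q′ *ℕ (2 + K) ≤⟨ ℕₚ.+-monoˡ-≤ _ (∣T∣≤a cT) ⟩
            (2 + K) *ℕ a + q′ *ℕ (2 + K) ≡⟨ cong (_+ q′ *ℕ (2 + K)) (ℕₚ.*-comm (2 + K) a) ⟩
            a *ℕ (2 + K) + q′ *ℕ (2 + K) ≡⟨ sym (ℕₚ.*-distribʳ-+ (2 + K) a q′) ⟩
            (a + q′) *ℕ (2 + K) ≤⟨ ℕₚ.*-monoˡ-≤ (2 + K) (ℕₚ.≤-trans (ℕₚ.≤-reflexive (ℕₚ.+-comm a q′)) q′+a≤q) ⟩
            q *ℕ (2 + K) <⟨ lt ⟩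
            suc f *ℕ ∣ T ∣ ∎)

    start-inv : Inv (λ _ → 0) ⊥
    start-inv = record
      { common = M₁.indep-⊥ , M₂.indep-⊥
      ; <K = λ v∈ → contradiction v∈ Subₚ.∉⊥
      ; priced = λ ()
      ; free₁ = λ _ iW _ → down₁ (∪-⊥ˡ (λ v∈ → Subₚ.∉⊥ (proj₁ (∈-level⁻ _ ⊥ v∈)))) iW }

    start-potential : ∀ {m} → (∀ {W} → Indep I₁ W → ∣ W ∣ ≤ m) → Potential≤ (λ _ → 0) (K *ℕ m)
    start-potential {m} rank W iW _ = ℕₚ.≤-trans (Σ<-mono K (λ t t<K → rank (iW t<K))) (ℕₚ.≤-reflexive (Σ<-const K m))

    -- The initial potential is K m with m ≤ 2 |T|, and a round uses up |T| of its multiple by 2 +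
    -- K. The extra round makes the fuel inequality strict.
    rounds : ℕ
    rounds = suc (2 *ℕ K *ℕ (2 + K))

    run-auction₀ : ∀ {m} → (∀ {W} → Indep I₁ W → ∣ W ∣ ≤ m) →
      Run O (auction rounds (λ _ → 0) ⊥) (rounds *ℕ (4 *ℕ n)) (λ J → CommonIndep I₁ I₂ J ×
        (∀ {T} → CommonIndep I₁ I₂ T → m ≤ 2 *ℕ ∣ T ∣ → K *ℕ ∣ T ∣ ≤ (2 + K) *ℕ ∣ J ∣))
    run-auction₀ {m} rank = run-weaken ℕₚ.≤-refl (λ J (c , near) → c , λ {T} cT m≤ → small-or-fuelled J near T cT m≤)
      (run-auction rounds start-inv (start-potential rank))
      where
      open ℕₚ.≤-Reasoning
      open import Algebra.Properties.CommutativeSemigroup ℕₚ.*-commutativeSemigroup using (xy∙z≈xz∙y; x∙yz≈yx∙z)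
      small-or-fuelled : ∀ J → (∀ {T} → CommonIndep I₁ I₂ T → K *ℕ m *ℕ (2 + K) < rounds *ℕ ∣ T ∣ → K *ℕ ∣ T ∣ ≤ (2 + K) *ℕ ∣ J ∣) →
        ∀ T → CommonIndep I₁ I₂ T → m ≤ 2 *ℕ ∣ T ∣ → K *ℕ ∣ T ∣ ≤ (2 + K) *ℕ ∣ J ∣
      small-or-fuelled J near T cT m≤ with ∣ T ∣ in eq
      -- For empty `T` the strict fuel inequality fails, but nothing has to be shown.
      ... | zero = ℕₚ.≤-trans (ℕₚ.≤-reflexive (ℕₚ.*-zeroʳ K)) z≤n
      ... | suc r = subst (λ t → K *ℕ t ≤ (2 + K) *ℕ ∣ J ∣) eq (near cT (begin-strict
        K *ℕ m *ℕ (2 + K) ≤⟨ ℕₚ.*-monoˡ-≤ (2 + K) (ℕₚ.*-monoʳ-≤ K m≤) ⟩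
        K *ℕ (2 *ℕ suc r) *ℕ (2 + K) ≡⟨ cong (_*ℕ (2 + K)) (x∙yz≈yx∙z K 2 (suc r)) ⟩
        2 *ℕ K *ℕ suc r *ℕ (2 + K) ≡⟨ xy∙z≈xz∙y (2 *ℕ K) (suc r) (2 + K) ⟩
        2 *ℕ K *ℕ (2 + K) *ℕ suc r <⟨ ℕₚ.m<n+m _ z<s ⟩
        rounds *ℕ suc r ≡⟨ cong (rounds *ℕ_) (sym eq) ⟩
        rounds *ℕ ∣ T ∣ ∎))

  -- Augmenting paths

  module _ {I : Oracle n} (M : IsMatroid I) where
    open Matroid M
    open IsMatroid M using (downClosed)

    -- x lies on the circuit of y in A ▹ x, which is also its circuit in V.
    indep-swap : ∀ {V A x y} → Indep I V → x ∈ V → A ⊆ V → x ∉ A →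
                 Indep I (A ▹ y) → ¬ Indep I (A ▹ x ▹ y) → Indep I (V ∖ ⁅ x ⁆ ▹ y)
    indep-swap {V} {A} {x} {y} iV x∈V A⊆V x∉A iAy dAxy with indep? (V ∖ ⁅ x ⁆ ▹ y)
    ... | yes i = i
    ... | no d = ⊥-elim (impossible (span-trans iAy spanned (inj₂ (λ i → dAxy (downClosed commute i)))))
      where
      spanned : ∀ {u} → u ∈ A ▹ y → Span (V ∖ ⁅ x ⁆) u
      spanned u∈ with ▹⁻ u∈
      ... | inj₁ u∈A = inj₁ (∖₁⁺ (A⊆V u∈A) (λ { refl → x∉A u∈A }))
      ... | inj₂ refl = inj₂ d
      commute : A ▹ x ▹ y ⊆ A ▹ y ▹ x
      commute = ▹-⊆ (▹-⊆ (λ v∈ → old (old v∈)) new) (old new)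
      impossible : ¬ Span (V ∖ ⁅ x ⁆) x
      impossible (inj₁ x∈) = proj₂ (∖₁⁻ x∈) refl
      impossible (inj₂ ¬i) = ¬i (downClosed (▹-⊆ (λ v∈ → proj₁ (∖₁⁻ v∈)) x∈V) iV)

  module AugmentProgram {n : ℕ} (k : ℕ) where

    -- The value on the empty list is a placeholder: the invariant of the search forces the list to
    -- be nonempty.
    firstOr : Fin n → List (Fin n) → Fin n
    firstOr y [] = y
    firstOr y (x ∷ _) = x

    -- Binary search for the first x in the chain A ⊆ A ▹ x₁ ⊆ A ▹ x₁ ▹ x₂ ⊆ … that closes a circuit with y.
    search : Bool → Fin n → ℕ → Subset n → List (Fin n) → Q n (Fin n)
    search i y zero A xs = ret (firstOr y xs)
    search i y (suc d) A xs =
      ask i (adjoin A (take (2 ^ d) xs) ▹ y) >>= λ b →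
      if b then search i y d (adjoin A (take (2 ^ d) xs)) (drop (2 ^ d) xs)
           else search i y d A (take (2 ^ d) xs)

    State : Set
    State = Subset n × (Fin n → Fin n)

    discover : Fin n → Fin n → State → State
    discover x y (X , parent) = X ▹ x , λ z → if does (z Finₚ.≟ x) then y else parent z

    module _ (S : Subset n) where

      -- Each pass adds to the visited set some x in S for which S - x + y is M₂-independent, until
      -- the circuit of `y` lies inside it. The visited set grows strictly within S, so `suc ∣ S ∣`
      -- passes suffice.
      close : Fin n → ℕ → State → Q n State
      close y zero st = ret st
      close y (suc f) st =
        ask true (proj₁ st ▹ y) >>= λ b →
        if b then (search true y k (proj₁ st) (elems (S ∖ proj₁ st)) >>= λ x → close y f (discover x y st))
             else ret st

      closeAll : List (Fin n) → State → Q n State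
      closeAll [] st = ret st
      closeAll (y ∷ ys) st = close y (suc ∣ S ∣) st >>= λ st′ → closeAll ys st′

      -- `x` is exchangeable for `y` in M₁ and for `parent x` in M₂, so the path gains these two
      -- vertices at its front.
      extend : State → Maybe (Fin n × Subset n) → Q n (Maybe (Fin n × Subset n))
      extend (X , parent) nothing = ret nothing
      extend (X , parent) (just (y , V)) =
        search false y k (S ∖ X) (elems X) >>= λ x → ret (just (parent x , V ∖ ⁅ x ⁆ ▹ parent x))

      -- Breadth-first search in the exchange graph of `S`, with `X` and `Y` the visited elements
      -- inside and outside `S`. A single query on `S ∖ X ▹ v` decides whether `v` is a source or
      -- M₁-exchangeable with any element of `X`, instead of one query per edge.
      layer : ℕ → Subset n → Subset n → Q n (Maybe (Fin n × Subset n))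
      finish : ℕ → Subset n → Subset n → Subset n → List (Fin n) → Q n (Maybe (Fin n × Subset n))

      layer zero X Y = ret nothing
      layer (suc l) X Y =
        grow (λ v _ → ask false (S ∖ X ▹ v)) (elems (∁ (S ∪ Y))) ⊥ >>= λ F →
        grow (λ v _ → ask true (S ▹ v)) (elems F) ⊥ >>= λ Z →
        finish l X Y F (elems Z)

      finish l X Y F (z ∷ _) = ret (just (z , S ▹ z))
      finish l X Y F [] =
        closeAll (elems F) (X , λ x → x) >>= λ st →
        layer l (proj₁ st) (Y ∪ F) >>= λ path → extend st path

    improve : ℕ → ℕ → Subset n → Q n (Subset n)
    again : ℕ → ℕ → Subset n → Maybe (Fin n × Subset n) → Q n (Subset n)
    improve l zero S = ret S
    improve l (suc f) S = layer S l ⊥ ⊥ >>= λ path → again l f S path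
    again l f S nothing = ret S
    again l f S (just (_ , V)) = improve l f V

  module Augment {n : ℕ} {I₁ I₂ : Oracle n} (M₁ : IsMatroid I₁) (M₂ : IsMatroid I₂) (k : ℕ) where
    open AugmentProgram {n} k
    module M₁ = Matroid M₁
    module M₂ = Matroid M₂
    open IsMatroid M₁ using () renaming (downClosed to down₁)
    open IsMatroid M₂ using () renaming (downClosed to down₂)

    O : Bool → Oracle n
    O = oracle I₁ I₂

    -- Binary search for an exchange

    module _ {i : Bool} (M : IsMatroid (O i)) where
      open IsMatroid M using (downClosed)

      Exchanges : Subset n → Fin n → List (Fin n) → Fin n → Set
      Exchanges S y xs x = x ∈ₗ xs × Indep (O i) (S ∖ ⁅ x ⁆ ▹ y)

      -- Halving keeps `y` independent over `A` and dependent once all of `xs` is added. When one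
      -- element is left, it lies on the circuit of `y`, and `indep-swap` turns this into an
      -- exchange in `S`.
      run-search : ∀ d {S y A xs} → Indep (O i) S → A ⊆ S → (∀ {x} → x ∈ₗ xs → x ∈ S) → length xs ≤ 2 ^ d →
                   Indep (O i) (A ▹ y) → ¬ Indep (O i) (adjoin A xs ▹ y) →
                   Run O (search i y d A xs) d (Exchanges S y xs)
      run-search zero {xs = []} iS A⊆ xs⊆ len iA dA = contradiction iA dA
      run-search zero {xs = _ ∷ _ ∷ _} iS A⊆ xs⊆ (s≤s ()) iA dA
      run-search zero {S} {y} {A} {x ∷ []} iS A⊆ xs⊆ len iA dA =
        run-ret (Any.here refl , indep-swap M iS (xs⊆ (Any.here refl)) A⊆
          (λ x∈A → dA (downClosed (▹-mono (▹-⊆ (λ v∈ → v∈) x∈A)) iA)) iA dA)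
      run-search (suc d) {S} {y} {A} {xs} iS A⊆ xs⊆ len iA dA =
        run-bind (run-ask i (adjoin A l ▹ y)) next
        where
        l r : List (Fin n)
        l = take (2 ^ d) xs
        r = drop (2 ^ d) xs
        split : l ++ r ≡ xs
        split = Listₚ.take++drop≡id (2 ^ d) xs
        l⊆ : ∀ {x} → x ∈ₗ l → x ∈ₗ xs
        l⊆ x∈ = subst (_ ∈ₗ_) split (∈-++⁺ˡ x∈)
        r⊆ : ∀ {x} → x ∈ₗ r → x ∈ₗ xs
        r⊆ x∈ = subst (_ ∈ₗ_) split (∈-++⁺ʳ l x∈)
        next : ∀ b → O i (adjoin A l ▹ y) ≡ b →
               Run O (if b then search i y d (adjoin A l) r else search i y d A l) d (Exchanges S y xs)
        next true j = run-weaken ℕₚ.≤-refl (λ x (x∈ , e) → r⊆ x∈ , e)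
          (run-search d iS (λ v∈ → [ A⊆ , (λ v∈l → xs⊆ (l⊆ v∈l)) ]′ (adjoin⁻ l v∈)) (λ x∈ → xs⊆ (r⊆ x∈))
            (ℕₚ.≤-trans (ℕₚ.≤-reflexive (Listₚ.length-drop (2 ^ d) xs))
              (ℕₚ.≤-trans (ℕₚ.∸-monoˡ-≤ (2 ^ d) len)
                (ℕₚ.≤-reflexive (trans (ℕₚ.m+n∸m≡n (2 ^ d) (2 ^ d + 0)) (ℕₚ.+-identityʳ _)))))
            j (λ i′ → dA (downClosed (▹-mono cover) i′)))
          where
          cover : adjoin A xs ⊆ adjoin (adjoin A l) r
          cover v∈ with adjoin⁻ xs v∈
          ... | inj₁ v∈A = adjoin⁺ r (inj₁ (adjoin⁺ l (inj₁ v∈A)))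
          ... | inj₂ v∈xs with ∈-++⁻ l (subst (_ ∈ₗ_) (sym split) v∈xs)
          ... | inj₁ v∈l = adjoin⁺ r (inj₁ (adjoin⁺ l (inj₂ v∈l)))
          ... | inj₂ v∈r = adjoin⁺ r (inj₂ v∈r)
        next false j = run-weaken ℕₚ.≤-refl (λ x (x∈ , e) → l⊆ x∈ , e)
          (run-search d iS A⊆ (λ x∈ → xs⊆ (l⊆ x∈))
            (ℕₚ.≤-trans (ℕₚ.≤-reflexive (Listₚ.length-take (2 ^ d) xs)) (ℕₚ.m⊓n≤m _ _))
            iA (dependent {I = O i} j))

    module _ {S : Subset n} (cS : CommonIndep I₁ I₂ S) (small : ∣ S ∣ ≤ 2 ^ k) where

      -- Closing a layer in M₂

      module _ (X₀ F : Subset n) (dependent₂ : ∀ {y} → y ∈ F → ¬ Indep I₂ (S ▹ y)) where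

        record Explored (st : State) : Set where
          private
            X = proj₁ st
            parent = proj₂ st
          field
            X₀⊆X : X₀ ⊆ X
            X⊆S : X ⊆ S
            found : ∀ {x} → x ∈ X → x ∉ X₀ → parent x ∈ F × Indep I₂ (S ∖ ⁅ x ⁆ ▹ parent x)

        -- A test either ends the work on its `y`, at one query for each `y`, or brings a new
        -- element into the visited set, paying one query and a search of depth `k`. As no element
        -- of `S` is visited twice, the second kind is charged over all layers together.
        record Closed (ys : List (Fin n)) (st st′ : State) (q : ℕ) : Set where
          field
            explored : Explored st′
            grown : proj₁ st ⊆ proj₁ st′
            closed : ∀ {y} → y ∈ₗ ys → ¬ Indep I₂ (proj₁ st′ ▹ y)
            amortised : q + suc k *ℕ ∣ proj₁ st ∣ ≤ length ys + suc k *ℕ ∣ proj₁ st′ ∣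

        explored-discover : ∀ {x y st} → Explored st → x ∈ S → x ∉ proj₁ st → y ∈ F →
                            Indep I₂ (S ∖ ⁅ x ⁆ ▹ y) → Explored (discover x y st)
        explored-discover {x} {y} {st} ex x∈S x∉X y∈F i = record
          { X₀⊆X = λ v∈ → old (X₀⊆X v∈) ; X⊆S = ▹-⊆ X⊆S x∈S ; found = found′ }
          where
          open Explored ex
          found′ : ∀ {z} → z ∈ proj₁ st ▹ x → z ∉ X₀ →
                   proj₂ (discover x y st) z ∈ F × Indep I₂ (S ∖ ⁅ z ⁆ ▹ proj₂ (discover x y st) z)
          found′ {z} z∈ z∉ = if-elim (λ w → w ∈ F × Indep I₂ (S ∖ ⁅ z ⁆ ▹ w)) (z Finₚ.≟ x)
            (λ { refl → y∈F , i })
            (λ z≢x → found ([ (λ z∈X → z∈X) , (λ z≡x → contradiction z≡x z≢x) ]′ (▹⁻ z∈)) z∉)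

        spec-close : ∀ f {y st} → y ∈ F → Explored st → ∣ S ∣ < f + ∣ proj₁ st ∣ →
                     Spec O (close S y f st) (Closed (y ∷ []) st)
        spec-close zero y∈F ex fuel = contradiction (Subₚ.p⊆q⇒∣p∣≤∣q∣ (Explored.X⊆S ex)) (ℕₚ.<⇒≱ fuel)
        spec-close (suc f) {y} {st} y∈F ex fuel = spec-bind (spec-run (run-ask true (X ▹ y))) next
          where
          X = proj₁ st
          open Explored ex
          next : ∀ b c → c ≤ 1 × I₂ (X ▹ y) ≡ b →
                 Spec O (if b then (search true y k X (elems (S ∖ X)) >>= λ x → close S y f (discover x y st)) else ret st)
                   (λ st′ d → Closed (y ∷ []) st st′ (c + d))
          next false c (c≤ , d) = mkSpec record
            { explored = ex ; grown = λ v∈ → v∈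
            ; closed = λ { (Any.here refl) → dependent {I = I₂} d }
            ; amortised = ℕₚ.+-monoˡ-≤ _ (ℕₚ.≤-trans (ℕₚ.≤-reflexive (ℕₚ.+-identityʳ c)) c≤) }
          next true c (c≤ , i) = spec-bind (spec-run (run-search {true} M₂ k (proj₂ cS) X⊆S
              (λ x∈ → proj₁ (∖⁻ (∈-elems⁻ x∈)))
              (ℕₚ.≤-trans (ℕₚ.≤-reflexive (length-elems (S ∖ X)))
                (ℕₚ.≤-trans (Subₚ.p⊆q⇒∣p∣≤∣q∣ {p = S ∖ X} {S} (λ v∈ → proj₁ (∖⁻ v∈))) small))
              i (λ i′ → dependent₂ y∈F (down₂ (▹-mono all) i′)))) after
            where
            all : S ⊆ adjoin X (elems (S ∖ X))
            all {v} v∈S with v ∈? X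
            ... | yes v∈X = adjoin⁺ (elems (S ∖ X)) (inj₁ v∈X)
            ... | no v∉X = adjoin⁺ (elems (S ∖ X)) (inj₂ (∈-elems⁺ (∖⁺ v∈S v∉X)))
            after : ∀ x d → d ≤ k × Exchanges {true} M₂ S y (elems (S ∖ X)) x →
                    Spec O (close S y f (discover x y st)) (λ st′ e → Closed (y ∷ []) st st′ (c + (d + e)))
            after x d (d≤ , x∈ , e) = spec-weaken (λ st′ q cl → let open Closed cl in record
                { explored = explored
                ; grown = λ v∈ → grown (old v∈)
                ; closed = closed
                ; amortised = begin
                    c + (d + q) + suc k *ℕ ∣ X ∣ ≤⟨ ℕₚ.+-monoˡ-≤ _ (ℕₚ.+-mono-≤ c≤ (ℕₚ.+-monoˡ-≤ q d≤)) ⟩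
                    suc k + q + suc k *ℕ ∣ X ∣ ≡⟨ cong (_+ suc k *ℕ ∣ X ∣) (ℕₚ.+-comm (suc k) q) ⟩
                    q + suc k + suc k *ℕ ∣ X ∣ ≡⟨ ℕₚ.+-assoc q (suc k) _ ⟩
                    q + (suc k + suc k *ℕ ∣ X ∣) ≡⟨ cong (q +_) (sym (ℕₚ.*-suc (suc k) ∣ X ∣)) ⟩
                    q + suc k *ℕ suc ∣ X ∣ ≡⟨ cong (λ z → q + suc k *ℕ z) (sym (∣▹∣ x∉X)) ⟩
                    q + suc k *ℕ ∣ X ▹ x ∣ ≤⟨ amortised ⟩
                    1 + suc k *ℕ ∣ proj₁ st′ ∣ ∎ })
              (spec-close f y∈F (explored-discover ex x∈S x∉X y∈F e)
                (ℕₚ.≤-trans fuel (ℕₚ.≤-reflexive (trans (sym (ℕₚ.+-suc f ∣ X ∣)) (cong (f +_) (sym (∣▹∣ x∉X)))))))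
              where
              open ℕₚ.≤-Reasoning
              x∈S : x ∈ S
              x∈S = proj₁ (∖⁻ (∈-elems⁻ x∈))
              x∉X : x ∉ X
              x∉X = proj₂ (∖⁻ (∈-elems⁻ x∈))

        spec-closeAll : ∀ ys {st} → (∀ {y} → y ∈ₗ ys → y ∈ F) → Explored st →
                        Spec O (closeAll S ys st) (Closed ys st)
        spec-closeAll [] ys⊆ ex = mkSpec record
          { explored = ex ; grown = λ v∈ → v∈ ; closed = λ () ; amortised = ℕₚ.≤-refl }
        spec-closeAll (y ∷ ys) {st} ys⊆ ex =
          spec-bind (spec-close (suc ∣ S ∣) (ys⊆ (Any.here refl)) ex (ℕₚ.m≤m+n (suc ∣ S ∣) _)) next
          where
          next : ∀ st₁ c → Closed (y ∷ []) st st₁ c →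
                 Spec O (closeAll S ys st₁) (λ st₂ d → Closed (y ∷ ys) st st₂ (c + d))
          next st₁ c cl₁ = spec-weaken both (spec-closeAll ys (λ y∈ → ys⊆ (Any.there y∈)) (Closed.explored cl₁))
            where
            both : ∀ st₂ d → Closed ys st₁ st₂ d → Closed (y ∷ ys) st st₂ (c + d)
            both st₂ d cl₂ = record
              { explored = Closed.explored cl₂
              ; grown = λ v∈ → Closed.grown cl₂ (Closed.grown cl₁ v∈)
              ; closed = λ { (Any.here refl) i → Closed.closed cl₁ (Any.here refl) (down₂ (▹-mono (Closed.grown cl₂)) i)
                           ; (Any.there y∈) → Closed.closed cl₂ y∈ }
              ; amortised = begin
                  c + d + a ≡⟨ xy∙z≈y∙xz c d a ⟩
                  d + (c + a) ≤⟨ ℕₚ.+-monoʳ-≤ d (Closed.amortised cl₁) ⟩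
                  d + suc b ≡⟨ ℕₚ.+-suc d b ⟩
                  suc (d + b) ≤⟨ s≤s (Closed.amortised cl₂) ⟩
                  suc (length ys) + suc k *ℕ ∣ proj₁ st₂ ∣ ∎ }
              where
              open ℕₚ.≤-Reasoning
              open import Algebra.Properties.CommutativeSemigroup ℕₚ.+-commutativeSemigroup using (xy∙z≈y∙xz)
              a b : ℕ
              a = suc k *ℕ ∣ proj₁ st ∣
              b = suc k *ℕ ∣ proj₁ st₁ ∣

      -- V is S augmented along the suffix of the path that starts at y; it need not be independent
      -- in M₁ before the predecessor of y has been removed, whence base.
      record Path (X Y : Subset n) (y : Fin n) (V : Subset n) : Set where
        field
          y∉S       : y ∉ S
          y∉Y       : y ∉ Y
          entry     : Indep I₁ (S ∖ X ▹ y)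
          indep₂    : Indep I₂ V
          X⊆V       : X ⊆ V
          base      : Indep I₁ (V ∖ ⁅ y ⁆)
          outside   : ∀ {u} → u ∈ V → u ∈ S ⊎ (u ∉ S × u ∉ Y)
          unreached : ∀ {u} → u ∈ V → u ≢ y → u ∈ S ⊎ ¬ Indep I₁ (S ∖ X ▹ u)
          size      : ∣ V ∣ ≡ suc ∣ S ∣

      -- For a failed search this is the sum of `∣T∣+∣X∣≤` over the remaining `l` layers: it
      -- telescopes, and the last visited set lies in `S`.
      Outcome : ℕ → Subset n → Subset n → Maybe (Fin n × Subset n) → Set
      Outcome l X Y (just (y , V)) = Path X Y y V
      Outcome l X Y nothing = ∀ {T} → CommonIndep I₁ I₂ T → l *ℕ ∣ T ∣ + ∣ X ∣ ≤ suc l *ℕ ∣ S ∣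

      -- Per layer: n queries for the frontier, n for the sinks, n for the tests that end the
      -- closing of each element, and k for the search made when the path is traced back.
      unit : ℕ
      unit = n + n + n + k

      Layered : ℕ → Subset n → Subset n → Maybe (Fin n × Subset n) → ℕ → Set
      Layered l X Y path q = Outcome l X Y path × q + suc k *ℕ ∣ X ∣ ≤ l *ℕ unit + suc k *ℕ ∣ S ∣

      record Frontier (X Y F : Subset n) : Set where
        field
          sound    : ∀ {v} → v ∈ F → v ∉ S × v ∉ Y × Indep I₁ (S ∖ X ▹ v)
          complete : ∀ {v} → v ∉ S → v ∉ Y → v ∉ F → ¬ Indep I₁ (S ∖ X ▹ v)

      -- Weak duality for the cut at `X′ ∪ (Y ∪ F)`: inside it `X′` spans in M₂, outside it `S ∖ X`
      -- spans in M₁.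
      ∣T∣+∣X∣≤ : ∀ {X X′ Y F T} → X ⊆ S → Frontier X Y F → X ⊆ X′ → X′ ⊆ S →
                 (∀ {v} → v ∈ Y ∪ F → ¬ Indep I₂ (X′ ▹ v)) →
                 CommonIndep I₁ I₂ T → ∣ T ∣ + ∣ X ∣ ≤ ∣ S ∣ + ∣ X′ ∣
      ∣T∣+∣X∣≤ {X} {X′} {Y} {F} {T} X⊆S fr X⊆X′ X′⊆S sp₂ (iT₁ , iT₂) = begin
        ∣ T ∣ + ∣ X ∣ ≤⟨ ℕₚ.+-monoˡ-≤ ∣ X ∣ (∣cover∣≤ {X = select left?} {select right?} split) ⟩
        ∣ select left? ∣ + ∣ select right? ∣ + ∣ X ∣ ≤⟨ ℕₚ.+-monoˡ-≤ ∣ X ∣ (ℕₚ.+-mono-≤ leftBound rightBound) ⟩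
        ∣ X′ ∣ + ∣ S ∖ X ∣ + ∣ X ∣ ≡⟨ ℕₚ.+-assoc ∣ X′ ∣ _ _ ⟩
        ∣ X′ ∣ + (∣ S ∖ X ∣ + ∣ X ∣) ≤⟨ ℕₚ.+-monoʳ-≤ ∣ X′ ∣ (∣disjoint∣≤ {X = S ∖ X} {X} {S} (λ v∈ → proj₁ (∖⁻ v∈)) X⊆S
                                                                    (λ v∈ v∈X → proj₂ (∖⁻ v∈) v∈X)) ⟩
        ∣ X′ ∣ + ∣ S ∣ ≡⟨ ℕₚ.+-comm ∣ X′ ∣ ∣ S ∣ ⟩
        ∣ S ∣ + ∣ X′ ∣ ∎
        where
        open ℕₚ.≤-Reasoning
        open Frontier fr
        left? : ∀ v → Dec (v ∈ T × v ∈ X′ ∪ (Y ∪ F))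
        left? v = (v ∈? T) ×-dec (v ∈? X′ ∪ (Y ∪ F))
        right? : ∀ v → Dec (v ∈ T × ¬ v ∈ X′ ∪ (Y ∪ F))
        right? v = (v ∈? T) ×-dec ¬? (v ∈? X′ ∪ (Y ∪ F))
        split : ∀ {v} → v ∈ T → v ∈ select left? ⊎ v ∈ select right?
        split {v} v∈T with v ∈? X′ ∪ (Y ∪ F)
        ... | yes v∈ = inj₁ (∈-select⁺ left? (v∈T , v∈))
        ... | no v∉ = inj₂ (∈-select⁺ right? (v∈T , v∉))
        leftBound : ∣ select left? ∣ ≤ ∣ X′ ∣
        leftBound = M₂.spanned-≤ (down₂ X′⊆S (proj₂ cS)) (down₂ (λ v∈ → proj₁ (∈-select⁻ left? v∈)) iT₂)
          (λ v∈ → [ inj₁ , (λ v∈YF → inj₂ (sp₂ v∈YF)) ]′ (Subₚ.x∈p∪q⁻ X′ _ (proj₂ (∈-select⁻ left? v∈))))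
        rightBound : ∣ select right? ∣ ≤ ∣ S ∖ X ∣
        rightBound = M₁.spanned-≤ (down₁ (λ v∈ → proj₁ (∖⁻ v∈)) (proj₁ cS)) (down₁ (λ v∈ → proj₁ (∈-select⁻ right? v∈)) iT₁)
          (λ v∈ → spanned (proj₂ (∈-select⁻ right? v∈)))
          where
          spanned : ∀ {v} → v ∉ X′ ∪ (Y ∪ F) → M₁.Span (S ∖ X) v
          spanned {v} v∉ with v ∈? S | v ∈? X
          ... | yes v∈S | no v∉X = inj₁ (∖⁺ v∈S v∉X)
          ... | no v∉S | _ = inj₂ (complete v∉S
            (λ v∈Y → v∉ (Subₚ.x∈p∪q⁺ (inj₂ (Subₚ.x∈p∪q⁺ (inj₁ v∈Y)))))
            (λ v∈F → v∉ (Subₚ.x∈p∪q⁺ (inj₂ (Subₚ.x∈p∪q⁺ (inj₂ v∈F))))))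
          ... | yes v∈S | yes v∈X = contradiction (Subₚ.x∈p∪q⁺ (inj₁ (X⊆X′ v∈X))) v∉

      -- Extending an augmenting path at its front

      module _ {X X′ Y F : Subset n} {parent : Fin n → Fin n} {y : Fin n} {V : Subset n}
               (fr : Frontier X Y F) (X′⊆S : X′ ⊆ S)
               (found : ∀ {x} → x ∈ X′ → x ∉ X → parent x ∈ F × Indep I₂ (S ∖ ⁅ x ⁆ ▹ parent x))
               (sp₂ : ∀ {v} → v ∈ Y ∪ F → ¬ Indep I₂ (X′ ▹ v))
               (X⊆X′ : X ⊆ X′) (path : Path X′ (Y ∪ F) y V) where
        private
          module P = Path path
        open Frontier fr

        -- The absence of shortcuts in breadth-first search: what is discovered after `F` cannot be
        -- entered from `X`.
        late : ∀ {v} → v ∉ S → v ∉ Y ∪ F → ¬ Indep I₁ (S ∖ X ▹ v)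
        late v∉S v∉ = complete v∉S (λ v∈Y → v∉ (Subₚ.x∈p∪q⁺ (inj₁ v∈Y))) (λ v∈F → v∉ (Subₚ.x∈p∪q⁺ (inj₂ v∈F)))

        -- In M₂ the circuit of `parent x` over `S` lies in `X′`, which `V` still contains, so the
        -- exchange valid in `S` is valid in `V`. In M₁ the other outside elements of `V` are
        -- spanned by `S ∖ X′`, hence by S - x, and `y` is independent over S - x.
        path-extend : ∀ {x} → x ∈ X′ → Indep I₁ (S ∖ ⁅ x ⁆ ▹ y) → Path X Y (parent x) (V ∖ ⁅ x ⁆ ▹ parent x)
        path-extend {x} x∈X′ i₁ = record
          { y∉S = proj₁ (sound z∈F)
          ; y∉Y = proj₁ (proj₂ (sound z∈F))
          ; entry = proj₂ (proj₂ (sound z∈F))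
          ; indep₂ = indep-swap M₂ P.indep₂ x∈V (λ v∈ → P.X⊆V (proj₁ (∖₁⁻ v∈))) (λ x∈ → proj₂ (∖₁⁻ x∈) refl)
              (down₂ (▹-mono (λ v∈ → let (v∈X′ , ne) = ∖₁⁻ v∈ in ∖₁⁺ (X′⊆S v∈X′) ne)) (proj₂ found′))
              (λ i → sp₂ (Subₚ.x∈p∪q⁺ (inj₂ z∈F)) (down₂ (▹-mono restore) i))
          ; X⊆V = λ v∈X → old (∖₁⁺ (P.X⊆V (X⊆X′ v∈X)) (λ { refl → x∉X v∈X }))
          ; base = down₁ shrink base′
          ; outside = λ u∈ → [ (λ u∈V → outside′ (proj₁ (∖₁⁻ u∈V))) , (λ { refl → inj₂ (proj₁ (sound z∈F) , proj₁ (proj₂ (sound z∈F))) }) ]′ (▹⁻ u∈)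
          ; unreached = λ u∈ ne → [ (λ u∈V → unreached′ (proj₁ (∖₁⁻ u∈V))) , (λ u≡z → contradiction u≡z ne) ]′ (▹⁻ u∈)
          ; size = trans (∣▹∣ {X = V ∖ ⁅ x ⁆} (λ z∈ → z∉V (proj₁ (∖₁⁻ z∈)))) (trans (∣∖₁∣ x∈V) P.size) }
          where
          -- Otherwise S - x would contain `S ∖ X`, and `y` would already have belonged to the
          -- frontier `F`.
          x∉X : x ∉ X
          x∉X x∈X = late P.y∉S P.y∉Y (down₁ (▹-mono
            (λ v∈ → let (v∈S , v∉X) = ∖⁻ v∈ in ∖₁⁺ v∈S (λ { refl → v∉X x∈X }))) i₁)
          found′ : parent x ∈ F × Indep I₂ (S ∖ ⁅ x ⁆ ▹ parent x)
          found′ = found x∈X′ x∉X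
          z∈F : parent x ∈ F
          z∈F = proj₁ found′
          x∈V : x ∈ V
          x∈V = P.X⊆V x∈X′
          z∉V : parent x ∉ V
          z∉V z∈V with P.outside z∈V
          ... | inj₁ z∈S = proj₁ (sound z∈F) z∈S
          ... | inj₂ (_ , z∉) = z∉ (Subₚ.x∈p∪q⁺ (inj₂ z∈F))
          restore : X′ ⊆ X′ ∖ ⁅ x ⁆ ▹ x
          restore {v} v∈ with v Finₚ.≟ x
          ... | yes refl = new
          ... | no ne = old (∖₁⁺ v∈ ne)
          base′ : Indep I₁ (V ∖ ⁅ x ⁆ ∖ ⁅ y ⁆ ▹ y)
          base′ = M₁.indep-▹ (down₁ (λ v∈ → let (a , ne) = ∖₁⁻ v∈ in ∖₁⁺ (proj₁ (∖₁⁻ a)) ne) P.base) spanned i₁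
                    (λ y∈ → P.y∉S (proj₁ (∖₁⁻ y∈)))
            where
            spanned : ∀ {v} → v ∈ V ∖ ⁅ x ⁆ ∖ ⁅ y ⁆ → M₁.Span (S ∖ ⁅ x ⁆) v
            spanned v∈ with ∖₁⁻ v∈
            ... | v∈Vx , v≢y with ∖₁⁻ v∈Vx
            ... | v∈V , v≢x with P.unreached v∈V v≢y
            ... | inj₁ v∈S = inj₁ (∖₁⁺ v∈S v≢x)
            ... | inj₂ d = inj₂ (λ i → d (down₁ (▹-mono
              (λ u∈ → let (u∈S , u∉) = ∖⁻ u∈ in ∖₁⁺ u∈S (λ { refl → u∉ x∈X′ }))) i))
          shrink : V ∖ ⁅ x ⁆ ▹ parent x ∖ ⁅ parent x ⁆ ⊆ V ∖ ⁅ x ⁆ ∖ ⁅ y ⁆ ▹ y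
          shrink {v} v∈ with ∖₁⁻ v∈
          ... | v∈▹ , v≢z with ▹⁻ v∈▹
          ... | inj₂ v≡z = contradiction v≡z v≢z
          ... | inj₁ v∈Vx with v Finₚ.≟ y
          ... | yes refl = new
          ... | no v≢y = old (∖₁⁺ v∈Vx v≢y)
          outside′ : ∀ {u} → u ∈ V → u ∈ S ⊎ (u ∉ S × u ∉ Y)
          outside′ u∈ with P.outside u∈
          ... | inj₁ u∈S = inj₁ u∈S
          ... | inj₂ (u∉S , u∉) = inj₂ (u∉S , λ u∈Y → u∉ (Subₚ.x∈p∪q⁺ (inj₁ u∈Y)))
          unreached′ : ∀ {u} → u ∈ V → u ∈ S ⊎ ¬ Indep I₁ (S ∖ X ▹ u)
          unreached′ u∈ with P.outside u∈
          ... | inj₁ u∈S = inj₁ u∈S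
          ... | inj₂ (u∉S , u∉) = inj₂ (late u∉S u∉)

        run-extend : ∀ l → Run O (extend S (X′ , parent) (just (y , V))) k (Outcome l X Y)
        run-extend l = run-≤ (ℕₚ.≤-reflexive (ℕₚ.+-identityʳ k)) (run-bind (run-search {false} M₁ k (proj₁ cS) (λ v∈ → proj₁ (∖⁻ v∈))
            (λ x∈ → X′⊆S (∈-elems⁻ x∈))
            (ℕₚ.≤-trans (ℕₚ.≤-reflexive (length-elems X′)) (ℕₚ.≤-trans (Subₚ.p⊆q⇒∣p∣≤∣q∣ X′⊆S) small))
            P.entry (λ i → late P.y∉S P.y∉Y (down₁ (▹-mono all) i)))
          (λ x (x∈ , i) → run-ret {c = 0} (path-extend (∈-elems⁻ x∈) i)))
          where
          all : S ∖ X ⊆ adjoin (S ∖ X′) (elems X′)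
          all {v} v∈ with v ∈? X′
          ... | yes v∈X′ = adjoin⁺ (elems X′) (inj₂ (∈-elems⁺ v∈X′))
          ... | no v∉X′ = adjoin⁺ (elems X′) (inj₁ (∖⁺ (proj₁ (∖⁻ v∈)) v∉X′))

      spec-layer : ∀ l {X Y} → X ⊆ S → (∀ {v} → v ∈ Y → ¬ Indep I₂ (X ▹ v)) → Spec O (layer S l X Y) (Layered l X Y)
      spec-finish : ∀ l {X Y F Z} → X ⊆ S → (∀ {v} → v ∈ Y → ¬ Indep I₂ (X ▹ v)) → Frontier X Y F →
        (∀ {z} → z ∈ₗ Z → z ∈ F × Indep I₂ (S ▹ z)) → (∀ {z} → z ∈ F → z ∉ₗ Z → ¬ Indep I₂ (S ▹ z)) →
        Spec O (finish S l X Y F Z)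
          (λ path q → Outcome (suc l) X Y path × q + suc k *ℕ ∣ X ∣ ≤ n + k + l *ℕ unit + suc k *ℕ ∣ S ∣)

      spec-layer zero X⊆S sp₂ = mkSpec
        ( (λ _ → ℕₚ.≤-trans (Subₚ.p⊆q⇒∣p∣≤∣q∣ X⊆S) (ℕₚ.≤-reflexive (sym (ℕₚ.*-identityˡ _))))
        , ℕₚ.*-monoʳ-≤ (suc k) (Subₚ.p⊆q⇒∣p∣≤∣q∣ X⊆S))
      spec-layer (suc l) {X} {Y} X⊆S sp₂ =
        spec-bind (spec-run (run-≤ (length-elems≤ (∁ (S ∪ Y))) (run-grow (λ v _ → run-ask false (S ∖ X ▹ v)) FrontierInv (elems (∁ (S ∪ Y))) stepF
          (λ v∈ → contradiction v∈ Subₚ.∉⊥)))) λ F c (c≤ , gF) →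
        spec-bind (spec-run (run-≤ (length-elems≤ F) (run-grow (λ v _ → run-ask true (S ▹ v)) (SinkInv F) (elems F) (stepZ F)
          (λ v∈ → contradiction v∈ Subₚ.∉⊥)))) λ Z d (d≤ , gZ) →
        spec-weaken (λ path q (o , q≤) → o , total c d q (∣ X ∣) (∣ S ∣) c≤ d≤ q≤)
          (spec-finish l X⊆S sp₂ (frontier F gF) (λ z∈ → Grown.inv gZ (∈-elems⁻ z∈))
            (λ {z} z∈F z∉Z i → z∉Z (∈-elems⁺ ([ (λ z∈ → z∈) , (λ (_ , _ , _ , d′) → contradiction i (dependent {I = I₂} d′)) ]′
                                    (Grown.maximal gZ (∈-elems⁺ z∈F))))))
        where
        FrontierInv : Subset n → Set
        FrontierInv F = ∀ {v} → v ∈ F → v ∉ S × v ∉ Y × Indep I₁ (S ∖ X ▹ v)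
        SinkInv : Subset n → Subset n → Set
        SinkInv F Z = ∀ {z} → z ∈ Z → z ∈ F × Indep I₂ (S ▹ z)
        stepF : ∀ {v F} → v ∈ₗ elems (∁ (S ∪ Y)) → FrontierInv F → I₁ (S ∖ X ▹ v) ≡ true → FrontierInv (F ▹ v)
        stepF v∈ inv i u∈ with ▹⁻ u∈
        ... | inj₁ u∈F = inv u∈F
        ... | inj₂ refl = (λ u∈S → out (Subₚ.x∈p∪q⁺ (inj₁ u∈S))) , (λ u∈Y → out (Subₚ.x∈p∪q⁺ (inj₂ u∈Y))) , i
          where out = Subₚ.x∈∁p⇒x∉p (∈-elems⁻ v∈)
        stepZ : ∀ F {v Z} → v ∈ₗ elems F → SinkInv F Z → I₂ (S ▹ v) ≡ true → SinkInv F (Z ▹ v)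
        stepZ F v∈ inv i u∈ with ▹⁻ u∈
        ... | inj₁ u∈Z = inv u∈Z
        ... | inj₂ refl = ∈-elems⁻ v∈ , i
        frontier : ∀ F → Grown (λ v _ → run-ask false (S ∖ X ▹ v)) FrontierInv (elems (∁ (S ∪ Y))) ⊥ F → Frontier X Y F
        frontier F g = record
          { sound = λ v∈ → Grown.inv g v∈
          ; complete = λ v∉S v∉Y v∉F → [ (λ v∈F → contradiction v∈F v∉F) , (λ (_ , _ , _ , d) → dependent {I = I₁} d) ]′
              (Grown.maximal g (∈-elems⁺ (Subₚ.x∉p⇒x∈∁p (λ v∈ → [ v∉S , v∉Y ]′ (Subₚ.x∈p∪q⁻ S Y v∈))))) }
        total : ∀ c d q x s → c ≤ n → d ≤ n → q + suc k *ℕ x ≤ n + k + l *ℕ unit + suc k *ℕ s →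
                c + (d + q) + suc k *ℕ x ≤ suc l *ℕ unit + suc k *ℕ s
        total c d q x s c≤ d≤ q≤ = begin
          c + (d + q) + suc k *ℕ x ≡⟨ cong (_+ suc k *ℕ x) (sym (ℕₚ.+-assoc c d q)) ⟩
          c + d + q + suc k *ℕ x ≡⟨ ℕₚ.+-assoc (c + d) q _ ⟩
          c + d + (q + suc k *ℕ x) ≤⟨ ℕₚ.+-mono-≤ (ℕₚ.+-mono-≤ c≤ d≤) q≤ ⟩
          n + n + (n + k + l *ℕ unit + suc k *ℕ s) ≡⟨ sym (ℕₚ.+-assoc (n + n) (n + k + l *ℕ unit) _) ⟩
          n + n + (n + k + l *ℕ unit) + suc k *ℕ s ≡⟨ cong (_+ suc k *ℕ s) (trans (sym (ℕₚ.+-assoc (n + n) (n + k) _)) (cong (_+ l *ℕ unit) (sym (ℕₚ.+-assoc (n + n) n k)))) ⟩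
          suc l *ℕ unit + suc k *ℕ s ∎
          where open ℕₚ.≤-Reasoning

      spec-finish l {X} {Y} {F} {z ∷ Z} X⊆S sp₂ fr isSink _ = mkSpec (record
          { y∉S = z∉S ; y∉Y = proj₁ (proj₂ (sound z∈F)) ; entry = proj₂ (proj₂ (sound z∈F))
          ; indep₂ = proj₂ (isSink (Any.here refl))
          ; X⊆V = λ v∈ → old (X⊆S v∈)
          ; base = down₁ inS (proj₁ cS)
          ; outside = λ u∈ → [ inj₁ , (λ { refl → inj₂ (z∉S , proj₁ (proj₂ (sound z∈F))) }) ]′ (▹⁻ u∈)
          ; unreached = λ u∈ ne → [ inj₁ , (λ e → contradiction e ne) ]′ (▹⁻ u∈)
          ; size = ∣▹∣ z∉S }
        , ℕₚ.≤-trans (ℕₚ.*-monoʳ-≤ (suc k) (Subₚ.p⊆q⇒∣p∣≤∣q∣ X⊆S)) (ℕₚ.m≤n+m _ (n + k + l *ℕ unit)))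
        where
        open Frontier fr
        z∈F : z ∈ F
        z∈F = proj₁ (isSink (Any.here refl))
        z∉S : z ∉ S
        z∉S = proj₁ (sound z∈F)
        inS : S ▹ z ∖ ⁅ z ⁆ ⊆ S
        inS v∈ with ∖₁⁻ v∈
        ... | v∈▹ , ne with ▹⁻ v∈▹
        ... | inj₁ v∈S = v∈S
        ... | inj₂ e = contradiction e ne
      spec-finish l {X} {Y} {F} {[]} X⊆S sp₂ fr _ noSink =
        spec-bind (spec-closeAll X F noSink′ (elems F) ∈-elems⁻ start) λ st c cl →
        spec-bind (spec-layer l (Explored.X⊆S (Closed.explored cl)) (sp₂′ cl)) λ path d (o , d≤) →
        done st c cl path d o d≤
        where
        noSink′ : ∀ {y} → y ∈ F → ¬ Indep I₂ (S ▹ y)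
        noSink′ y∈F = noSink y∈F (λ ())
        start : Explored X F noSink′ (X , λ x → x)
        start = record { X₀⊆X = λ v∈ → v∈ ; X⊆S = X⊆S ; found = λ x∈ x∉ → contradiction x∈ x∉ }
        Cl : State → ℕ → Set
        Cl st c = Closed X F noSink′ (elems F) (X , λ x → x) st c
        sp₂′ : ∀ {st c} → Cl st c → ∀ {v} → v ∈ Y ∪ F → ¬ Indep I₂ (proj₁ st ▹ v)
        sp₂′ cl v∈ i with Subₚ.x∈p∪q⁻ Y F v∈
        ... | inj₁ v∈Y = sp₂ v∈Y (down₂ (▹-mono (Closed.grown cl)) i)
        ... | inj₂ v∈F = Closed.closed cl (∈-elems⁺ v∈F) i
        budget : ∀ {st c} → Cl st c → ∀ d → d + suc k *ℕ ∣ proj₁ st ∣ ≤ l *ℕ unit + suc k *ℕ ∣ S ∣ → ∀ e → e ≤ k →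
                 c + (d + e) + suc k *ℕ ∣ X ∣ ≤ n + k + l *ℕ unit + suc k *ℕ ∣ S ∣
        budget {st} {c} cl d d≤ e e≤ = begin
          c + (d + e) + a ≡⟨ cong (λ z → c + z + a) (ℕₚ.+-comm d e) ⟩
          c + (e + d) + a ≡⟨ ℕₚ.+-assoc c (e + d) a ⟩
          c + (e + d + a) ≡⟨ cong (c +_) (ℕₚ.+-comm (e + d) a) ⟩
          c + (a + (e + d)) ≡⟨ sym (ℕₚ.+-assoc c a (e + d)) ⟩
          c + a + (e + d) ≤⟨ ℕₚ.+-monoˡ-≤ (e + d) (Closed.amortised cl) ⟩
          length (elems F) + b + (e + d) ≤⟨ ℕₚ.+-monoˡ-≤ (e + d) (ℕₚ.+-monoˡ-≤ b (ℕₚ.≤-trans (ℕₚ.≤-reflexive (length-elems F)) (Subₚ.∣p∣≤n F))) ⟩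
          n + b + (e + d) ≡⟨ interchange n b e d ⟩
          n + e + (b + d) ≡⟨ cong (n + e +_) (ℕₚ.+-comm b d) ⟩
          n + e + (d + b) ≤⟨ ℕₚ.+-mono-≤ (ℕₚ.+-monoʳ-≤ n e≤) d≤ ⟩
          n + k + (l *ℕ unit + suc k *ℕ ∣ S ∣) ≡⟨ sym (ℕₚ.+-assoc (n + k) _ _) ⟩
          n + k + l *ℕ unit + suc k *ℕ ∣ S ∣ ∎
          where
          open ℕₚ.≤-Reasoning
          open import Algebra.Properties.CommutativeSemigroup ℕₚ.+-commutativeSemigroup using (interchange)
          a b : ℕ
          a = suc k *ℕ ∣ X ∣
          b = suc k *ℕ ∣ proj₁ st ∣
        done : ∀ st c → Cl st c → ∀ path d → Outcome l (proj₁ st) (Y ∪ F) path →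
               d + suc k *ℕ ∣ proj₁ st ∣ ≤ l *ℕ unit + suc k *ℕ ∣ S ∣ →
               Spec O (extend S st path) (λ path′ e → Outcome (suc l) X Y path′ ×
                 c + (d + e) + suc k *ℕ ∣ X ∣ ≤ n + k + l *ℕ unit + suc k *ℕ ∣ S ∣)
        done st c cl nothing d o d≤ = mkSpec ((λ {T} cT → begin
            suc l *ℕ ∣ T ∣ + ∣ X ∣ ≡⟨ xy∙z≈xz∙y (∣ T ∣) (l *ℕ ∣ T ∣) (∣ X ∣) ⟩
            ∣ T ∣ + ∣ X ∣ + l *ℕ ∣ T ∣ ≤⟨ ℕₚ.+-monoˡ-≤ (l *ℕ ∣ T ∣) (∣T∣+∣X∣≤ X⊆S fr (Closed.grown cl) (Explored.X⊆S (Closed.explored cl)) (sp₂′ cl) cT) ⟩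
            ∣ S ∣ + ∣ proj₁ st ∣ + l *ℕ ∣ T ∣ ≡⟨ ℕₚ.+-assoc (∣ S ∣) _ _ ⟩
            ∣ S ∣ + (∣ proj₁ st ∣ + l *ℕ ∣ T ∣) ≡⟨ cong (∣ S ∣ +_) (ℕₚ.+-comm (∣ proj₁ st ∣) _) ⟩
            ∣ S ∣ + (l *ℕ ∣ T ∣ + ∣ proj₁ st ∣) ≤⟨ ℕₚ.+-monoʳ-≤ (∣ S ∣) (o cT) ⟩
            suc (suc l) *ℕ ∣ S ∣ ∎) , budget cl d d≤ 0 z≤n)
          where
          open ℕₚ.≤-Reasoning
          open import Algebra.Properties.CommutativeSemigroup ℕₚ.+-commutativeSemigroup using (xy∙z≈xz∙y)
        done st c cl (just (y , V)) d path d≤ =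
          spec-weaken (λ path′ e (e≤ , o) → o , budget cl d d≤ e e≤)
            (spec-run (run-extend fr (Explored.X⊆S (Closed.explored cl)) (Explored.found (Closed.explored cl))
              (sp₂′ cl) (Closed.grown cl) path (suc l)))

    -- Either all `f` searches succeed and each adds one element, or a failing one is itself the
    -- certificate, read off at an empty visited set.
    run-improve : ∀ l f {S m} → CommonIndep I₁ I₂ S → (∀ {T} → CommonIndep I₁ I₂ T → ∣ T ∣ ≤ m) → m ≤ 2 ^ k →
      Run O (improve l f S) (f *ℕ (l *ℕ (n + n + n + k) + suc k *ℕ m)) (λ S′ → CommonIndep I₁ I₂ S′ ×
        (∣ S ∣ + f ≤ ∣ S′ ∣ ⊎ (∀ {T} → CommonIndep I₁ I₂ T → l *ℕ ∣ T ∣ ≤ suc l *ℕ ∣ S′ ∣)))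
    run-improve l zero {S} cS max m≤ = run-ret (cS , inj₁ (ℕₚ.≤-reflexive (ℕₚ.+-identityʳ ∣ S ∣)))
    run-improve l (suc f) {S} {m} cS max m≤ = run-bind layered next
      where
      small : ∣ S ∣ ≤ 2 ^ k
      small = ℕₚ.≤-trans (max cS) m≤
      round : ℕ
      round = l *ℕ (n + n + n + k) + suc k *ℕ m
      Result : ℕ → Subset n → Subset n → Set
      Result f S S′ = CommonIndep I₁ I₂ S′ × (∣ S ∣ + f ≤ ∣ S′ ∣ ⊎ (∀ {T} → CommonIndep I₁ I₂ T → l *ℕ ∣ T ∣ ≤ suc l *ℕ ∣ S′ ∣))
      layered : Run O (layer S l ⊥ ⊥) round (Outcome cS small l ⊥ ⊥)
      layered = let (o , q≤) = holds (spec-layer cS small l Subₚ.⊥⊆ (λ v∈ → contradiction v∈ Subₚ.∉⊥)) in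
        mkRun (ℕₚ.≤-trans (ℕₚ.m≤m+n _ _) (ℕₚ.≤-trans q≤ (ℕₚ.+-monoʳ-≤ (l *ℕ (n + n + n + k)) (ℕₚ.*-monoʳ-≤ (suc k) (max cS))))) o
      next : ∀ path → Outcome cS small l ⊥ ⊥ path → Run O (again l f S path) (f *ℕ round) (Result (suc f) S)
      next nothing o = run-ret (cS , inj₂ (λ cT → ℕₚ.≤-trans (ℕₚ.m≤m+n _ _) (o cT)))
      next (just (y , V)) path = run-weaken ℕₚ.≤-refl
        (λ S′ (cS′ , r) → cS′ , [ (λ le → inj₁ (ℕₚ.≤-trans (ℕₚ.≤-reflexive (trans (ℕₚ.+-suc ∣ S ∣ f) (cong (_+ f) (sym size)))) le)) , inj₂ ]′ r)
        (run-improve l f (indep₁ , indep₂) max m≤)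
        where
        open Path path
        direct : ∀ {u} → Indep I₁ (S ∖ ⊥ ▹ u) → Indep I₁ (S ▹ u)
        direct = down₁ (▹-mono (λ v∈ → ∖⁺ v∈ Subₚ.∉⊥))
        -- At the start of the path nothing is visited: `S` spans `V` without `y`, while `y` is a
        -- source, so M₁-independence extends from `base` to all of `V`.
        indep₁ : Indep I₁ V
        indep₁ = down₁ shrink (M₁.indep-▹ base spanned (direct entry) y∉S)
          where
          spanned : ∀ {v} → v ∈ V ∖ ⁅ y ⁆ → M₁.Span S v
          spanned v∈ with unreached (proj₁ (∖₁⁻ v∈)) (proj₂ (∖₁⁻ v∈))
          ... | inj₁ v∈S = inj₁ v∈S
          ... | inj₂ d = inj₂ (λ i → d (down₁ (▹-mono (λ u∈ → proj₁ (∖⁻ u∈))) i))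
          shrink : V ⊆ V ∖ ⁅ y ⁆ ▹ y
          shrink {v} v∈ with v Finₚ.≟ y
          ... | yes refl = new
          ... | no ne = old (∖₁⁺ v∈ ne)

  -- Truncation

  trunc : ℕ → Oracle n → Oracle n
  trunc m I X = if does (∣ X ∣ ≤? m) then I X else false

  -- Queries on sets that are too large are answered without the oracle, so the simulation costs no
  -- more than a run on the truncated matroid.
  truncate : ℕ → Q n A → Q n A
  truncate m (ret a) = ret a
  truncate m (ask false X) = if does (∣ X ∣ ≤? m) then ask false X else ret false
  truncate m (ask true X) = ask true X
  truncate m (q >>= f) = truncate m q >>= λ a → truncate m (f a)

  module _ (m : ℕ) (I₁ I₂ : Oracle n) where
    val-truncate : (q : Q n A) → val (oracle I₁ I₂) (truncate m q) ≡ val (oracle (trunc m I₁) I₂) q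
    val-truncate (ret a) = refl
    val-truncate (ask false X) with does (∣ X ∣ ≤? m)
    ... | true = refl
    ... | false = refl
    val-truncate (ask true X) = refl
    val-truncate (q >>= f) rewrite val-truncate q = val-truncate (f _)

    cost-truncate : (q : Q n A) → cost (oracle I₁ I₂) (truncate m q) ≤ cost (oracle (trunc m I₁) I₂) q
    cost-truncate (ret a) = z≤n
    cost-truncate (ask false X) with does (∣ X ∣ ≤? m)
    ... | true = ℕₚ.≤-refl
    ... | false = z≤n
    cost-truncate (ask true X) = ℕₚ.≤-refl
    cost-truncate (q >>= f) rewrite val-truncate q = ℕₚ.+-mono-≤ (cost-truncate q) (cost-truncate (f _))

    run-truncate : ∀ {q : Q n A} {c P} → Run (oracle (trunc m I₁) I₂) q c P → Run (oracle I₁ I₂) (truncate m q) c P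
    run-truncate {q = q} {P = P} r =
      mkRun (ℕₚ.≤-trans (cost-truncate q) (cost≤ r)) (subst P (sym (val-truncate q)) (post r))

  module _ {m : ℕ} {I : Oracle n} where
    trunc⁺ : ∀ {X} → Indep I X → ∣ X ∣ ≤ m → Indep (trunc m I) X
    trunc⁺ {X} i le = if-elim (_≡ true) (∣ X ∣ ≤? m) (λ _ → i) (λ ¬le → contradiction le ¬le)

    trunc⁻ : ∀ {X} → Indep (trunc m I) X → Indep I X × ∣ X ∣ ≤ m
    trunc⁻ {X} = if-elim (λ b → b ≡ true → Indep I X × ∣ X ∣ ≤ m) (∣ X ∣ ≤? m) (λ le i → i , le) (λ _ ())

    trunc-matroid : IsMatroid I → IsMatroid (trunc m I)
    trunc-matroid M = record
      { nonempty = ⊥ , trunc⁺ (Matroid.indep-⊥ M) (ℕₚ.≤-trans (ℕₚ.≤-reflexive (Subₚ.∣⊥∣≡0 n)) z≤n)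
      ; downClosed = λ S⊆T iT → let (i , le) = trunc⁻ iT in
          trunc⁺ (downClosed S⊆T i) (ℕₚ.≤-trans (Subₚ.p⊆q⇒∣p∣≤∣q∣ S⊆T) le)
      ; exchange = λ iS iT lt → let (x , x∈S , x∉T , i) = exchange (proj₁ (trunc⁻ iS)) (proj₁ (trunc⁻ iT)) lt in
          x , x∈S , x∉T , trunc⁺ i (ℕₚ.≤-trans (ℕₚ.≤-reflexive (∣▹∣ x∉T)) (ℕₚ.≤-trans lt (proj₂ (trunc⁻ iS)))) }
      where open IsMatroid M

  -- Greedy 2-approximation

  both : Fin n → Subset n → Q n Bool
  both v X = ask false (X ▹ v) >>= λ b → if b then ask true (X ▹ v) else ret false

  greedy : Q n (Subset n)
  greedy = grow both (elems ⊤) ⊥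

  module _ {I₁ I₂ : Oracle n} (M₁ : IsMatroid I₁) (M₂ : IsMatroid I₂) where
    private
      module M₁ = Matroid M₁
      module M₂ = Matroid M₂
      O = oracle I₁ I₂

      Both : Fin n → Subset n → Bool → Set
      Both v X true = CommonIndep I₁ I₂ (X ▹ v)
      Both v X false = ¬ Indep I₁ (X ▹ v) ⊎ ¬ Indep I₂ (X ▹ v)

      run-both : ∀ v X → Run O (both v X) 2 (Both v X)
      run-both v X = run-bind (run-ask false (X ▹ v)) next
        where
        next : ∀ b → I₁ (X ▹ v) ≡ b → Run O (if b then ask true (X ▹ v) else ret false) 1 (Both v X)
        next false d = run-ret (inj₁ (dependent {I = I₁} d))
        next true i = run-weaken ℕₚ.≤-refl (λ { true j → i , j ; false d → inj₂ (dependent {I = I₂} d) })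
          (run-ask true (X ▹ v))

    -- By maximality `S` spans each element of `T` in M₁ or in M₂, and either class has at most |S|
    -- elements.
    run-greedy : Run O greedy (n *ℕ 2) (λ S → CommonIndep I₁ I₂ S × (∀ {T} → CommonIndep I₁ I₂ T → ∣ T ∣ ≤ 2 *ℕ ∣ S ∣))
    run-greedy = run-weaken (ℕₚ.≤-reflexive (cong (_*ℕ 2) (trans (length-elems {n} ⊤) (Subₚ.∣⊤∣≡n n)))) good
      (run-grow run-both (CommonIndep I₁ I₂) (elems ⊤) (λ _ _ i → i) (M₁.indep-⊥ , M₂.indep-⊥))
      where
      good : ∀ S → Grown run-both (CommonIndep I₁ I₂) (elems ⊤) ⊥ S →
             CommonIndep I₁ I₂ S × (∀ {T} → CommonIndep I₁ I₂ T → ∣ T ∣ ≤ 2 *ℕ ∣ S ∣)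
      good S g = inv , bound
        where
        open Grown g
        bound : ∀ {T} → CommonIndep I₁ I₂ T → ∣ T ∣ ≤ 2 *ℕ ∣ S ∣
        bound {T} (iT₁ , iT₂) = ℕₚ.≤-trans (∣cover∣≤ {X = select spanned₁?} {select free₁?} split)
          (ℕₚ.≤-trans (ℕₚ.+-mono-≤
            (M₁.spanned-≤ (proj₁ inv) (IsMatroid.downClosed M₁ (λ v∈ → proj₁ (∈-select⁻ spanned₁? v∈)) iT₁)
              (λ v∈ → inj₂ (proj₂ (∈-select⁻ spanned₁? v∈))))
            (M₂.spanned-≤ (proj₂ inv) (IsMatroid.downClosed M₂ (λ v∈ → proj₁ (∈-select⁻ free₁? v∈)) iT₂)
              (λ v∈ → spanned₂ (proj₂ (∈-select⁻ free₁? v∈)))))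
            (ℕₚ.≤-reflexive (cong (∣ S ∣ +_) (sym (ℕₚ.+-identityʳ ∣ S ∣)))))
          where
          spanned₁? : ∀ v → Dec (v ∈ T × ¬ Indep I₁ (S ▹ v))
          spanned₁? v = (v ∈? T) ×-dec ¬? (M₁.indep? (S ▹ v))
          free₁? : ∀ v → Dec (v ∈ T × Indep I₁ (S ▹ v))
          free₁? v = (v ∈? T) ×-dec M₁.indep? (S ▹ v)
          split : ∀ {v} → v ∈ T → v ∈ select spanned₁? ⊎ v ∈ select free₁?
          split {v} v∈T with M₁.indep? (S ▹ v)
          ... | yes i = inj₂ (∈-select⁺ free₁? (v∈T , i))
          ... | no d = inj₁ (∈-select⁺ spanned₁? (v∈T , d))
          spanned₂ : ∀ {v} → Indep I₁ (S ▹ v) → M₂.Span S v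
          spanned₂ {v} i with maximal (∈-elems⁺ (Subₚ.∈⊤ {x = v}))
          ... | inj₁ v∈S = inj₁ v∈S
          ... | inj₂ (Y , _ , Y⊆S , inj₁ d) = contradiction (IsMatroid.downClosed M₁ (▹-mono Y⊆S) i) d
          ... | inj₂ (Y , _ , Y⊆S , inj₂ d) = M₂.span-mono Y⊆S (inj₂ d)

  -- The combined algorithm

  isqrt : ∀ m → ∃[ s ] (s *ℕ s ≤ m × m < suc s *ℕ suc s)
  isqrt zero = 0 , z≤n , z<s
  isqrt (suc m) with isqrt m
  ... | s , lo , hi with suc s *ℕ suc s ≤? suc m
  ... | yes le = suc s , le , ℕₚ.≤-<-trans hi (ℕₚ.*-mono-< (ℕₚ.n<1+n (suc s)) (ℕₚ.n<1+n (suc s)))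
  ... | no gt = s , ℕₚ.m≤n⇒m≤1+n lo , ℕₚ.≰⇒> gt

  n<2^n : ∀ n → n < 2 ^ n
  n<2^n zero = z<s
  n<2^n (suc n) = begin-strict
    1 + n <⟨ ℕₚ.+-mono-≤-< (ℕₚ.m^n>0 2 n) (n<2^n n) ⟩
    2 ^ n + 2 ^ n ≡⟨ cong (2 ^ n +_) (sym (ℕₚ.+-identityʳ (2 ^ n))) ⟩
    2 ^ suc n ∎
    where open ℕₚ.≤-Reasoning

  auctionTruncated : ℕ → ℕ → Q n (Subset n)
  auctionTruncated m K = truncate m (AuctionProgram.auction K (suc (2 *ℕ K *ℕ (2 + K))) (λ _ → 0) ⊥)

  -- suc s + suc s bounds both the number of augmentations that remain after the coarse auction and
  -- the depth of the binary searches, because ∣ S ∣ ≤ m < (1 + s)² ≤ 2 ^ (2 + 2 s).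
  approxFrom : ℕ → Subset n → Q n (Subset n)
  approxFrom K S₀ =
    if does (K ≤? s) then auctionTruncated m K
    else (auctionTruncated m (suc s) >>= AugmentProgram.improve (suc s + suc s) K (suc s + suc s))
    where
    m = 2 *ℕ ∣ S₀ ∣
    s = proj₁ (isqrt m)

  approx : ℕ → Q n (Subset n)
  approx K = greedy >>= approxFrom K

  module _ {I₁ I₂ : Oracle n} (M₁ : IsMatroid I₁) (M₂ : IsMatroid I₂) where
    private
      O = oracle I₁ I₂

    run-auctionTruncated : ∀ {m K T} → CommonIndep I₁ I₂ T → ∣ T ∣ ≤ m → m ≤ 2 *ℕ ∣ T ∣ →
      Run O (auctionTruncated m K) (suc (2 *ℕ K *ℕ (2 + K)) *ℕ (4 *ℕ n))
        (λ J → CommonIndep I₁ I₂ J × K *ℕ ∣ T ∣ ≤ (2 + K) *ℕ ∣ J ∣)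
    run-auctionTruncated {m} {K} {T} (i₁ , i₂) ≤m m≤ = run-truncate m I₁ I₂
      (run-weaken ℕₚ.≤-refl (λ J ((j₁ , j₂) , near) → (proj₁ (trunc⁻ {I = I₁} j₁) , j₂) , near (trunc⁺ {I = I₁} i₁ ≤m , i₂) m≤)
        (Auction.run-auction₀ (trunc-matroid M₁) M₂ K (λ iW → proj₂ (trunc⁻ {I = I₁} iW))))

    module _ {K r : ℕ} (1≤K : 1 ≤ K) (1≤n : 1 ≤ n) {T : Subset n} (cT : CommonIndep I₁ I₂ T) (∣T∣≡r : ∣ T ∣ ≡ r)
             (max : ∀ {X} → CommonIndep I₁ I₂ X → ∣ X ∣ ≤ r) where

      Good : Subset n → Set
      Good S = CommonIndep I₁ I₂ S × K *ℕ r ≤ (2 + K) *ℕ ∣ S ∣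

      -- 4 n (1 + 4 k + 2 k²) ≤ 28 n k² for k ≥ 1. It serves both branches: k is `K` in the coarse
      -- one and `t` in the fine one.
      auction-cost : ∀ {k t} → 1 ≤ k → k ≤ K → k ≤ t → suc (2 *ℕ k *ℕ (2 + k)) *ℕ (4 *ℕ n) ≤ 28 *ℕ (n *ℕ (K *ℕ t))
      auction-cost {k} {t} 1≤k k≤K k≤t = begin
        suc (2 *ℕ k *ℕ (2 + k)) *ℕ (4 *ℕ n)
          ≡⟨ solve 2 (λ k n → (con 1 :+ con 2 :* k :* (con 2 :+ k)) :* (con 4 :* n) :=
               con 4 :* n :* (con 1 :+ con 4 :* k :+ con 2 :* (k :* k))) refl k n ⟩
        4 *ℕ n *ℕ (1 + 4 *ℕ k + 2 *ℕ (k *ℕ k))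
          ≤⟨ ℕₚ.*-monoʳ-≤ (4 *ℕ n) (ℕₚ.+-monoˡ-≤ (2 *ℕ (k *ℕ k)) (ℕₚ.+-mono-≤ (ℕₚ.*-mono-≤ 1≤k 1≤k) (ℕₚ.*-monoʳ-≤ 4 k≤kk))) ⟩
        4 *ℕ n *ℕ (k *ℕ k + 4 *ℕ (k *ℕ k) + 2 *ℕ (k *ℕ k))
          ≡⟨ solve 2 (λ x n → con 4 :* n :* (x :+ con 4 :* x :+ con 2 :* x) := con 28 :* (n :* x)) refl (k *ℕ k) n ⟩
        28 *ℕ (n *ℕ (k *ℕ k)) ≤⟨ ℕₚ.*-monoʳ-≤ 28 (ℕₚ.*-monoʳ-≤ n (ℕₚ.*-mono-≤ k≤K k≤t)) ⟩
        28 *ℕ (n *ℕ (K *ℕ t)) ∎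
        where
        open ℕₚ.≤-Reasoning
        open +-*-Solver
        k≤kk : k ≤ k *ℕ k
        k≤kk = ℕₚ.≤-trans (ℕₚ.≤-reflexive (sym (ℕₚ.*-identityˡ k))) (ℕₚ.*-monoˡ-≤ k 1≤k)

      -- The constant is 2 · (9 + 6): 2 t searches, each with K (3 n + 2 t) ≤ 9 n K for the layers
      -- and (2 t + 1) m ≤ 3 K · 2 n for the amortised closing.
      improve-cost : ∀ {t m} → 1 ≤ t → t ≤ K → t ≤ 3 *ℕ n → m ≤ 2 *ℕ n →
        (t + t) *ℕ (K *ℕ (n + n + n + (t + t)) + suc (t + t) *ℕ m) ≤ 30 *ℕ (n *ℕ (K *ℕ t))
      improve-cost {t} {m} 1≤t t≤K t≤3n m≤ = begin
        (t + t) *ℕ (K *ℕ (n + n + n + (t + t)) + suc (t + t) *ℕ m)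
          ≤⟨ ℕₚ.*-monoʳ-≤ (t + t) (ℕₚ.+-mono-≤ (ℕₚ.*-monoʳ-≤ K (ℕₚ.+-monoʳ-≤ (n + n + n) (ℕₚ.+-mono-≤ t≤3n t≤3n)))
               (ℕₚ.*-mono-≤ (ℕₚ.+-mono-≤ (ℕₚ.≤-trans 1≤t t≤K) (ℕₚ.+-mono-≤ t≤K t≤K)) m≤)) ⟩
        (t + t) *ℕ (K *ℕ (n + n + n + (3 *ℕ n + 3 *ℕ n)) + (K + (K + K)) *ℕ (2 *ℕ n))
          ≡⟨ solve 3 (λ t K n → (t :+ t) :* (K :* (n :+ n :+ n :+ (con 3 :* n :+ con 3 :* n)) :+ (K :+ (K :+ K)) :* (con 2 :* n))
               := con 30 :* (n :* (K :* t))) refl t K n ⟩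
        30 *ℕ (n *ℕ (K *ℕ t)) ∎
        where
        open ℕₚ.≤-Reasoning
        open +-*-Solver

      run-approxFrom : ∀ {S₀} → CommonIndep I₁ I₂ S₀ → (∀ {X} → CommonIndep I₁ I₂ X → ∣ X ∣ ≤ 2 *ℕ ∣ S₀ ∣) →
        Run O (approxFrom K S₀) (58 *ℕ (n *ℕ (K *ℕ suc (proj₁ (isqrt (2 *ℕ ∣ S₀ ∣)))))) Good
      run-approxFrom {S₀} c₀ half = if-elim (λ q → Run O q (58 *ℕ (n *ℕ (K *ℕ t))) Good) (K ≤? s) coarse fine
        where
        open ℕₚ.≤-Reasoning
        m s t : ℕ
        m = 2 *ℕ ∣ S₀ ∣
        s = proj₁ (isqrt m)
        t = suc s
        s²≤m : s *ℕ s ≤ m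
        s²≤m = proj₁ (proj₂ (isqrt m))
        m<t² : m < t *ℕ t
        m<t² = proj₂ (proj₂ (isqrt m))
        auctionRun : ∀ K′ → Run O (auctionTruncated m K′) (suc (2 *ℕ K′ *ℕ (2 + K′)) *ℕ (4 *ℕ n))
          (λ J → CommonIndep I₁ I₂ J × K′ *ℕ ∣ T ∣ ≤ (2 + K′) *ℕ ∣ J ∣)
        auctionRun K′ = run-auctionTruncated cT (half cT)
          (ℕₚ.*-monoʳ-≤ 2 (ℕₚ.≤-trans (max c₀) (ℕₚ.≤-reflexive (sym ∣T∣≡r))))
        coarse : K ≤ s → Run O (auctionTruncated m K) (58 *ℕ (n *ℕ (K *ℕ t))) Good
        coarse K≤s = run-weaken
          (ℕₚ.≤-trans (auction-cost 1≤K ℕₚ.≤-refl (ℕₚ.m≤n⇒m≤1+n K≤s)) (ℕₚ.*-monoˡ-≤ (n *ℕ (K *ℕ t)) (ℕₚ.m≤m+n 28 30)))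
          (λ J (c , near) → c , subst (λ z → K *ℕ z ≤ (2 + K) *ℕ ∣ J ∣) ∣T∣≡r near) (auctionRun K)
        m≤2n : m ≤ 2 *ℕ n
        m≤2n = ℕₚ.*-monoʳ-≤ 2 (Subₚ.∣p∣≤n S₀)
        s≤s² : ∀ s → s ≤ s *ℕ s
        s≤s² zero = z≤n
        s≤s² (suc s) = ℕₚ.m≤m+n (suc s) _
        t≤3n : t ≤ 3 *ℕ n
        t≤3n = ℕₚ.+-mono-≤ 1≤n (ℕₚ.≤-trans (s≤s² s) (ℕₚ.≤-trans s²≤m m≤2n))
        m≤2^ : m ≤ 2 ^ (t + t)
        m≤2^ = begin
          m ≤⟨ ℕₚ.<⇒≤ m<t² ⟩
          t *ℕ t ≤⟨ ℕₚ.*-mono-≤ (ℕₚ.<⇒≤ (n<2^n t)) (ℕₚ.<⇒≤ (n<2^n t)) ⟩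
          2 ^ t *ℕ 2 ^ t ≡⟨ sym (ℕₚ.^-distribˡ-+-* 2 t t) ⟩
          2 ^ (t + t) ∎
        fine : ¬ (K ≤ s) → Run O (auctionTruncated m t >>= AugmentProgram.improve (t + t) K (t + t)) (58 *ℕ (n *ℕ (K *ℕ t))) Good
        fine K≰s = run-≤ (ℕₚ.≤-trans (ℕₚ.+-mono-≤ (auction-cost (s≤s z≤n) t≤K ℕₚ.≤-refl) (improve-cost (s≤s z≤n) t≤K t≤3n m≤2n))
            (ℕₚ.≤-reflexive (sym (ℕₚ.*-distribʳ-+ (n *ℕ (K *ℕ t)) 28 30))))
          (run-bind (auctionRun t) λ J (cJ , near) →
            run-weaken ℕₚ.≤-refl (λ S (cS , r) → cS , [ exact J cJ near S , (λ h → close S (h cT)) ]′ r)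
              (Augment.run-improve M₁ M₂ (t + t) K (t + t) cJ half m≤2^))
          where
          t≤K : t ≤ K
          t≤K = ℕₚ.≰⇒> K≰s
          close : ∀ S → K *ℕ ∣ T ∣ ≤ suc K *ℕ ∣ S ∣ → K *ℕ r ≤ (2 + K) *ℕ ∣ S ∣
          close S h = ℕₚ.≤-trans (subst (λ z → K *ℕ z ≤ suc K *ℕ ∣ S ∣) ∣T∣≡r h) (ℕₚ.m≤n+m _ ∣ S ∣)
          -- From |J| ≤ t² the coarse auction yields t |T| ≤ t (|J| + 2 t), so at most 2 t elements
          -- are missing and that many augmentations reach the optimum.
          exact : ∀ J → CommonIndep I₁ I₂ J → t *ℕ ∣ T ∣ ≤ (2 + t) *ℕ ∣ J ∣ → ∀ S → ∣ J ∣ + (t + t) ≤ ∣ S ∣ → K *ℕ r ≤ (2 + K) *ℕ ∣ S ∣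
          exact J cJ near S grown = ℕₚ.*-mono-≤ (ℕₚ.m≤n+m K 2) (ℕₚ.≤-trans (subst (_≤ ∣ J ∣ + (t + t)) ∣T∣≡r
            (ℕₚ.*-cancelˡ-≤ t (begin
              t *ℕ ∣ T ∣ ≤⟨ near ⟩
              (2 + t) *ℕ ∣ J ∣ ≡⟨ solve 2 (λ t j → (con 2 :+ t) :* j := t :* j :+ (j :+ j)) refl t (∣ J ∣) ⟩
              t *ℕ ∣ J ∣ + (∣ J ∣ + ∣ J ∣) ≤⟨ ℕₚ.+-monoʳ-≤ (t *ℕ ∣ J ∣) (ℕₚ.+-mono-≤ J≤ J≤) ⟩
              t *ℕ ∣ J ∣ + (t *ℕ t + t *ℕ t) ≡⟨ solve 2 (λ t j → t :* j :+ (t :* t :+ t :* t) := t :* (j :+ (t :+ t))) refl t (∣ J ∣) ⟩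
              t *ℕ (∣ J ∣ + (t + t)) ∎))) grown)
            where
            open +-*-Solver
            J≤ : ∣ J ∣ ≤ t *ℕ t
            J≤ = ℕₚ.≤-trans (half cJ) (ℕₚ.<⇒≤ m<t²)

      -- The root is kept as a natural number `s`, so that only naturals occur until the bound is
      -- squared. The constant is 58 plus 2 for the greedy start.
      spec-approx : Spec O (approx K) (λ S q → Good S × ∃[ s ] (s *ℕ s ≤ 2 *ℕ r × q ≤ 60 *ℕ (n *ℕ (K *ℕ suc s))))
      spec-approx = spec-bind (spec-run (run-greedy M₁ M₂)) λ S₀ c (c≤ , c₀ , half) →
        spec-weaken (λ S q (q≤ , good) → good , _ ,
            ℕₚ.≤-trans (proj₁ (proj₂ (isqrt (2 *ℕ ∣ S₀ ∣)))) (ℕₚ.*-monoʳ-≤ 2 (max c₀)) ,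
            ℕₚ.≤-trans (ℕₚ.+-mono-≤ (ℕₚ.≤-trans c≤ (start (proj₁ (isqrt (2 *ℕ ∣ S₀ ∣))))) q≤)
              (ℕₚ.≤-reflexive (sym (ℕₚ.*-distribʳ-+ (n *ℕ (K *ℕ suc (proj₁ (isqrt (2 *ℕ ∣ S₀ ∣))))) 2 58))))
          (spec-run (run-approxFrom c₀ half))
        where
        start : ∀ s → n *ℕ 2 ≤ 2 *ℕ (n *ℕ (K *ℕ suc s))
        start s = ℕₚ.≤-trans (ℕₚ.≤-reflexive (ℕₚ.*-comm n 2)) (ℕₚ.*-monoʳ-≤ 2
          (ℕₚ.≤-trans (ℕₚ.≤-reflexive (sym (ℕₚ.*-identityʳ n))) (ℕₚ.*-monoʳ-≤ n (ℕₚ.*-mono-≤ 1≤K (s≤s z≤n)))))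

open Algorithm
open import Data.Nat using (zero; s≤s; z≤n)
import Data.Nat.Solver as ℕSolver
open import Data.Nat.DivMod using (m/n*n≤m; m≡m%n+[m/n]*n; m%n<n)
open import Data.Nat.Logarithm using (⌈log₂⌉-mono-≤)
open import Data.Integer using (+_; -[1+_])
import Data.Integer as ℤ
import Data.Integer.Properties as ℤₚ
open import Data.Rational using (ℚ; mkℚ; 0ℚ; 1ℚ; _-_; _*_; _≤_; _<_; toℚᵘ)
import Data.Rational as ℚ
import Data.Rational.Properties as ℚₚ
import Data.Rational.Solver as ℚSolver
open import Data.Rational.Unnormalised using (mkℚᵘ; *≡*) renaming (_≃_ to _≃ᵘ_)
import Data.Rational.Unnormalised as ℚᵘ
import Data.Rational.Unnormalised.Properties as ℚᵘₚ
open import Data.Bool using (if_then_else_)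
open import Data.Vec using ([])
open import Data.Fin.Subset using (Subset; ⊥)
open import Relation.Nullary using (does; contradiction)

-- Accuracy and query count over the rationals

toℚᵘ-ℕtoℚ : ∀ m → toℚᵘ (ℕtoℚ m) ≃ᵘ mkℚᵘ (+ m) 0
toℚᵘ-ℕtoℚ m = ℚₚ.toℚᵘ-fromℚᵘ (mkℚᵘ (+ m) 0)

ℕtoℚ-+ : ∀ m n → ℕtoℚ (m + n) ≡ ℕtoℚ m ℚ.+ ℕtoℚ n
ℕtoℚ-+ m n = ℚₚ.toℚᵘ-injective (begin
  toℚᵘ (ℕtoℚ (m + n)) ≈⟨ toℚᵘ-ℕtoℚ (m + n) ⟩
  mkℚᵘ (+ (m + n)) 0 ≈⟨ *≡* (cong (ℤ._* + 1) (cong₂ ℤ._+_ (sym (ℤₚ.*-identityʳ (+ m))) (sym (ℤₚ.*-identityʳ (+ n))))) ⟩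
  mkℚᵘ (+ m) 0 ℚᵘ.+ mkℚᵘ (+ n) 0 ≈⟨ ℚᵘₚ.≃-sym (ℚᵘₚ.+-cong (toℚᵘ-ℕtoℚ m) (toℚᵘ-ℕtoℚ n)) ⟩
  toℚᵘ (ℕtoℚ m) ℚᵘ.+ toℚᵘ (ℕtoℚ n) ≈⟨ ℚᵘₚ.≃-sym (ℚₚ.toℚᵘ-homo-+ (ℕtoℚ m) (ℕtoℚ n)) ⟩
  toℚᵘ (ℕtoℚ m ℚ.+ ℕtoℚ n) ∎)
  where open ℚᵘₚ.≃-Reasoning

ℕtoℚ-* : ∀ m n → ℕtoℚ (m *ℕ n) ≡ ℕtoℚ m * ℕtoℚ n
ℕtoℚ-* m n = ℚₚ.toℚᵘ-injective (begin
  toℚᵘ (ℕtoℚ (m *ℕ n)) ≈⟨ toℚᵘ-ℕtoℚ (m *ℕ n) ⟩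
  mkℚᵘ (+ (m *ℕ n)) 0 ≈⟨ *≡* (cong (ℤ._* + 1) (ℤₚ.pos-* m n)) ⟩
  mkℚᵘ (+ m) 0 ℚᵘ.* mkℚᵘ (+ n) 0 ≈⟨ ℚᵘₚ.≃-sym (ℚᵘₚ.*-cong (toℚᵘ-ℕtoℚ m) (toℚᵘ-ℕtoℚ n)) ⟩
  toℚᵘ (ℕtoℚ m) ℚᵘ.* toℚᵘ (ℕtoℚ n) ≈⟨ ℚᵘₚ.≃-sym (ℚₚ.toℚᵘ-homo-* (ℕtoℚ m) (ℕtoℚ n)) ⟩
  toℚᵘ (ℕtoℚ m * ℕtoℚ n) ∎)
  where open ℚᵘₚ.≃-Reasoning

ℕtoℚ-mono : ∀ {m n} → m ℕ.≤ n → ℕtoℚ m ≤ ℕtoℚ n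
ℕtoℚ-mono {m} {n} m≤n = ℚₚ.toℚᵘ-cancel-≤ (ℚᵘₚ.≤-respˡ-≃ (ℚᵘₚ.≃-sym (toℚᵘ-ℕtoℚ m)) (ℚᵘₚ.≤-respʳ-≃ (ℚᵘₚ.≃-sym (toℚᵘ-ℕtoℚ n))
  (ℚᵘ.*≤* (ℤₚ.*-monoʳ-≤-nonNeg (+ 1) (ℤ.+≤+ m≤n)))))

*-denominator : ∀ {a d} (ε : ℚ) → toℚᵘ ε ≡ mkℚᵘ (+ a) d → ε * ℕtoℚ (suc d) ≡ ℕtoℚ a
*-denominator {a} {d} ε eq = ℚₚ.toℚᵘ-injective (begin
  toℚᵘ (ε * ℕtoℚ (suc d)) ≈⟨ ℚₚ.toℚᵘ-homo-* ε (ℕtoℚ (suc d)) ⟩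
  toℚᵘ ε ℚᵘ.* toℚᵘ (ℕtoℚ (suc d)) ≈⟨ ℚᵘₚ.*-cong (ℚᵘₚ.≃-reflexive eq) (toℚᵘ-ℕtoℚ (suc d)) ⟩
  mkℚᵘ (+ a) d ℚᵘ.* mkℚᵘ (+ suc d) 0 ≈⟨ *≡* (trans (ℤₚ.*-identityʳ (+ a ℤ.* + suc d))
                                        (cong (λ z → + a ℤ.* + z) (sym (ℕₚ.*-identityʳ (suc d))))) ⟩
  mkℚᵘ (+ a) 0 ≈⟨ ℚᵘₚ.≃-sym (toℚᵘ-ℕtoℚ a) ⟩
  toℚᵘ (ℕtoℚ a) ∎)
  where open ℚᵘₚ.≃-Reasoning

ℕtoℚ-pos : ∀ d → ℚ.Positive (ℕtoℚ (suc d))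
ℕtoℚ-pos d = ℚₚ.normalize-pos (suc d) 1

module _ (ε : ℚ) (a d : ℕ) (ε*b≡a : ε * ℕtoℚ (suc d) ≡ ℕtoℚ a) where
  private
    b = suc d
    instance
      b-pos : ℚ.Positive (ℕtoℚ b)
      b-pos = ℕtoℚ-pos d

  -- Multiplying by the denominator b of ε turns ε b into a and leaves an inequality between
  -- naturals.
  approximation : ∀ r s → b *ℕ r ℕ.≤ a *ℕ r + b *ℕ s → (1ℚ - ε) * ℕtoℚ r ≤ ℕtoℚ s
  approximation r s le = ℚₚ.*-cancelʳ-≤-pos (ℕtoℚ b) (begin
    (1ℚ - ε) * ℕtoℚ r * ℕtoℚ b
      ≡⟨ solve 3 (λ e r b → (con 1ℚ :+ :- e) :* r :* b := b :* r :+ :- (e :* b :* r)) refl ε (ℕtoℚ r) (ℕtoℚ b) ⟩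
    ℕtoℚ b * ℕtoℚ r - ε * ℕtoℚ b * ℕtoℚ r
      ≡⟨ cong₂ _-_ (sym (ℕtoℚ-* b r)) (trans (cong (_* ℕtoℚ r) ε*b≡a) (sym (ℕtoℚ-* a r))) ⟩
    ℕtoℚ (b *ℕ r) - ℕtoℚ (a *ℕ r) ≤⟨ ℚₚ.+-monoˡ-≤ (ℚ.- ℕtoℚ (a *ℕ r)) (ℕtoℚ-mono le) ⟩
    ℕtoℚ (a *ℕ r + b *ℕ s) - ℕtoℚ (a *ℕ r)
      ≡⟨ cong (_- ℕtoℚ (a *ℕ r)) (trans (ℕtoℚ-+ (a *ℕ r) (b *ℕ s)) (cong (ℕtoℚ (a *ℕ r) ℚ.+_) (ℕtoℚ-* b s))) ⟩
    ℕtoℚ (a *ℕ r) ℚ.+ ℕtoℚ b * ℕtoℚ s - ℕtoℚ (a *ℕ r)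
      ≡⟨ solve 3 (λ x b s → x :+ b :* s :+ :- x := s :* b) refl (ℕtoℚ (a *ℕ r)) (ℕtoℚ b) (ℕtoℚ s) ⟩
    ℕtoℚ s * ℕtoℚ b ∎)
    where
    open ℚₚ.≤-Reasoning
    open ℚSolver.+-*-Solver

  query-bound : ∀ q N → q *ℕ q *ℕ (a *ℕ a) ℕ.≤ N *ℕ (b *ℕ b) → (ℕtoℚ q * ℕtoℚ q) * (ε * ε) ≤ ℕtoℚ N
  query-bound q N le = ℚₚ.*-cancelʳ-≤-pos (ℕtoℚ b) (ℚₚ.*-cancelʳ-≤-pos (ℕtoℚ b) (begin
    (ℕtoℚ q * ℕtoℚ q) * (ε * ε) * ℕtoℚ b * ℕtoℚ b
      ≡⟨ solve 3 (λ q e b → (q :* q) :* (e :* e) :* b :* b := (q :* q) :* ((e :* b) :* (e :* b))) refl (ℕtoℚ q) ε (ℕtoℚ b) ⟩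
    (ℕtoℚ q * ℕtoℚ q) * ((ε * ℕtoℚ b) * (ε * ℕtoℚ b)) ≡⟨ cong (λ z → (ℕtoℚ q * ℕtoℚ q) * (z * z)) ε*b≡a ⟩
    (ℕtoℚ q * ℕtoℚ q) * (ℕtoℚ a * ℕtoℚ a) ≡⟨ sym (trans (ℕtoℚ-* (q *ℕ q) (a *ℕ a)) (cong₂ _*_ (ℕtoℚ-* q q) (ℕtoℚ-* a a))) ⟩
    ℕtoℚ (q *ℕ q *ℕ (a *ℕ a)) ≤⟨ ℕtoℚ-mono le ⟩
    ℕtoℚ (N *ℕ (b *ℕ b)) ≡⟨ trans (ℕtoℚ-* N (b *ℕ b)) (cong (ℕtoℚ N *_) (ℕtoℚ-* b b)) ⟩
    ℕtoℚ N * (ℕtoℚ b * ℕtoℚ b) ≡⟨ sym (ℚₚ.*-assoc (ℕtoℚ N) (ℕtoℚ b) (ℕtoℚ b)) ⟩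
    ℕtoℚ N * ℕtoℚ b * ℕtoℚ b ∎))
    where
    open ℚₚ.≤-Reasoning
    open ℚSolver.+-*-Solver

-- For ε = a / b this is the least K with K a > 2 b.
steps : ℚ → ℕ
steps (mkℚ (+ suc a) d _) = suc ((2 *ℕ suc d) ℕ./ suc a)
steps _ = 1

record Steps (ε : ℚ) : Set where
  field
    a d    : ℕ
    ratio  : ε * ℕtoℚ (suc d) ≡ ℕtoℚ a
    1≤K    : 1 ℕ.≤ steps ε
    enough : 2 *ℕ suc d ℕ.≤ steps ε *ℕ a
    few    : steps ε *ℕ a ℕ.≤ 3 *ℕ suc d

steps-spec : ∀ ε → 0ℚ < ε → ε < 1ℚ → Steps ε
steps-spec (mkℚ (+ zero) d c) (ℚ.*<* 0<) ε<1 = contradiction 0< (ℤₚ.<-irrefl (sym (ℤₚ.*-zeroˡ (+ 1))))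
steps-spec (mkℚ -[1+ a ] d c) (ℚ.*<* ()) ε<1
steps-spec ε@(mkℚ (+ suc a) d _) 0<ε (ℚ.*<* lt) = record
  { a = suc a ; d = d ; ratio = *-denominator ε refl
  ; 1≤K = s≤s z≤n
  ; enough = ℕₚ.≤-trans (ℕₚ.≤-reflexive (m≡m%n+[m/n]*n (2 *ℕ suc d) (suc a)))
      (ℕₚ.+-monoˡ-≤ _ (ℕₚ.<⇒≤ (m%n<n (2 *ℕ suc d) (suc a))))
  -- K a is at most a + 2 b, and a < b is where ε < 1 enters.
  ; few = ℕₚ.+-mono-≤ (ℕₚ.<⇒≤ a<b) (m/n*n≤m (2 *ℕ suc d) (suc a)) }
  where
  a<b : suc a ℕ.< suc d
  a<b = ℤₚ.drop‿+<+ (subst₂ ℤ._<_ (ℤₚ.*-identityʳ (+ suc a)) (ℤₚ.*-identityˡ (+ suc d)) lt)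

-- The decision tree and its constants

alg : (n : ℕ) → ℚ → QueryTree n
alg zero ε = output ⊥
alg (suc n) ε = if does (1ℚ ℚ.≤? ε) then output ⊥ else toTree (approx (steps ε)) output

-- The hypothesis `near` says K (r - s) ≤ 2 s; with s ≤ r and 2 b ≤ K a the loss r - s is at most (a
-- / b) r.
size-bound : ∀ K a b r s → 1 ℕ.≤ K → 2 *ℕ b ℕ.≤ K *ℕ a → s ℕ.≤ r → K *ℕ r ℕ.≤ (2 + K) *ℕ s →
             b *ℕ r ℕ.≤ a *ℕ r + b *ℕ s
size-bound (suc k) a b r s _ enough s≤r near = ℕₚ.*-cancelˡ-≤ K (begin
  K *ℕ (b *ℕ r) ≡⟨ solve 3 (λ K b r → K :* (b :* r) := b :* (K :* r)) refl K b r ⟩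
  b *ℕ (K *ℕ r) ≤⟨ ℕₚ.*-monoʳ-≤ b near ⟩
  b *ℕ ((2 + K) *ℕ s) ≡⟨ solve 3 (λ K b s → b :* ((con 2 :+ K) :* s) := (con 2 :* b) :* s :+ K :* (b :* s)) refl K b s ⟩
  (2 *ℕ b) *ℕ s + K *ℕ (b *ℕ s) ≤⟨ ℕₚ.+-monoˡ-≤ (K *ℕ (b *ℕ s)) (ℕₚ.*-mono-≤ enough s≤r) ⟩
  (K *ℕ a) *ℕ r + K *ℕ (b *ℕ s) ≡⟨ solve 5 (λ K a r b s → (K :* a) :* r :+ K :* (b :* s) := K :* (a :* r :+ b :* s)) refl K a r b s ⟩
  K *ℕ (a *ℕ r + b *ℕ s) ∎)
  where
  K = suc k
  open ℕₚ.≤-Reasoning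
  open ℕSolver.+-*-Solver

-- The factor 36 is 4 · 9, from (s + 1)² ≤ 4 (r + 1) and (K a)² ≤ (3 b)².
cost-bound : ∀ c n K a b r s q ℓ → K *ℕ a ℕ.≤ 3 *ℕ b → s *ℕ s ℕ.≤ 2 *ℕ r → q ℕ.≤ c *ℕ (n *ℕ (K *ℕ suc s)) → 1 ℕ.≤ ℓ →
             q *ℕ q *ℕ (a *ℕ a) ℕ.≤ c *ℕ c *ℕ 36 *ℕ (n *ℕ n) *ℕ (suc r *ℕ ℓ) *ℕ (b *ℕ b)
cost-bound c n K a b r s q ℓ few s² q≤ 1≤ℓ = begin
  q *ℕ q *ℕ (a *ℕ a) ≤⟨ ℕₚ.*-monoˡ-≤ (a *ℕ a) (ℕₚ.*-mono-≤ q≤ q≤) ⟩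
  (c *ℕ (n *ℕ (K *ℕ suc s))) *ℕ (c *ℕ (n *ℕ (K *ℕ suc s))) *ℕ (a *ℕ a)
    ≡⟨ solve 5 (λ c n K t a → (c :* (n :* (K :* t))) :* (c :* (n :* (K :* t))) :* (a :* a)
         := c :* c :* (n :* n) :* (t :* t) :* ((K :* a) :* (K :* a))) refl c n K (suc s) a ⟩
  c *ℕ c *ℕ (n *ℕ n) *ℕ (suc s *ℕ suc s) *ℕ ((K *ℕ a) *ℕ (K *ℕ a))
    ≤⟨ ℕₚ.*-mono-≤ (ℕₚ.*-monoʳ-≤ (c *ℕ c *ℕ (n *ℕ n)) t²) (ℕₚ.*-mono-≤ few few) ⟩
  c *ℕ c *ℕ (n *ℕ n) *ℕ (4 *ℕ (suc r *ℕ ℓ)) *ℕ ((3 *ℕ b) *ℕ (3 *ℕ b))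
    ≡⟨ solve 4 (λ c n x b → c :* c :* (n :* n) :* (con 4 :* x) :* ((con 3 :* b) :* (con 3 :* b))
         := c :* c :* con 36 :* (n :* n) :* x :* (b :* b)) refl c n (suc r *ℕ ℓ) b ⟩
  c *ℕ c *ℕ 36 *ℕ (n *ℕ n) *ℕ (suc r *ℕ ℓ) *ℕ (b *ℕ b) ∎
  where
  open ℕₚ.≤-Reasoning
  open ℕSolver.+-*-Solver
  2s≤ : ∀ s → 2 *ℕ s ℕ.≤ 1 + s *ℕ s
  2s≤ zero = z≤n
  2s≤ (suc zero) = ℕₚ.≤-refl
  2s≤ (suc (suc s)) = ℕₚ.m≤n⇒m≤1+n (ℕₚ.*-monoˡ-≤ (suc (suc s)) {2} {suc (suc s)} (s≤s (s≤s z≤n)))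
  t² : suc s *ℕ suc s ℕ.≤ 4 *ℕ (suc r *ℕ ℓ)
  t² = begin
    suc s *ℕ suc s ≡⟨ solve 1 (λ s → (con 1 :+ s) :* (con 1 :+ s) := con 2 :* s :+ (con 1 :+ s :* s)) refl s ⟩
    2 *ℕ s + (1 + s *ℕ s) ≤⟨ ℕₚ.+-mono-≤ (ℕₚ.≤-trans (2s≤ s) (s≤s s²)) (s≤s s²) ⟩
    (1 + 2 *ℕ r) + (1 + 2 *ℕ r) ≤⟨ ℕₚ.m≤n+m _ 2 ⟩
    2 + ((1 + 2 *ℕ r) + (1 + 2 *ℕ r)) ≡⟨ solve 1 (λ r → con 2 :+ ((con 1 :+ con 2 :* r) :+ (con 1 :+ con 2 :* r)) := con 4 :* ((con 1 :+ r) :* con 1)) refl r ⟩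
    4 *ℕ (suc r *ℕ 1) ≤⟨ ℕₚ.*-monoʳ-≤ 4 (ℕₚ.*-monoʳ-≤ (suc r) 1≤ℓ) ⟩
    4 *ℕ (suc r *ℕ ℓ) ∎

-- Kept opaque so that products with the constant do not unfold into long sums.
abstract
  queryFactor : ℕ
  queryFactor = 60

  60≤queryFactor : 60 ℕ.≤ queryFactor
  60≤queryFactor = ℕₚ.≤-refl

constant : ℕ
constant = queryFactor *ℕ queryFactor *ℕ 36

-- The shift by 2 keeps the logarithm at least 1 even for r = 0.
1≤⌈log₂⌉ : ∀ r → 1 ℕ.≤ ⌈log₂ (r + 2) ⌉
1≤⌈log₂⌉ r = ⌈log₂⌉-mono-≤ (ℕₚ.m≤n+m 2 r)

module _ {n : ℕ} {I₁ I₂ : Oracle n} {r : ℕ} (M₁ : IsMatroid I₁) (M₂ : IsMatroid I₂)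
         (max : IsMaxCommonSize I₁ I₂ r) (ε : ℚ) where

  Solves : ℕ → QueryTree n → Set
  Solves C t = CommonIndep I₁ I₂ (proj₁ (run I₁ I₂ t)) ×
    ((1ℚ - ε) * ℕtoℚ r ≤ ℕtoℚ ∣ proj₁ (run I₁ I₂ t) ∣) ×
    ((ℕtoℚ (proj₂ (run I₁ I₂ t)) * ℕtoℚ (proj₂ (run I₁ I₂ t))) * (ε * ε)
      ≤ ℕtoℚ (C *ℕ (n *ℕ n) *ℕ (suc r *ℕ ⌈log₂ (r + 2) ⌉)))

  solves-⊥ : ∀ C → (1ℚ - ε) * ℕtoℚ r ≤ 0ℚ → Solves C (output ⊥)
  solves-⊥ C le = (Matroid.indep-⊥ M₁ , Matroid.indep-⊥ M₂) , ℚₚ.≤-trans le (ℕtoℚ-mono {0} {∣ ⊥ {n} ∣} z≤n) ,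
    ℚₚ.≤-trans (ℚₚ.≤-reflexive (ℚₚ.*-zeroˡ (ε * ε))) (ℕtoℚ-mono {0} {C *ℕ (n *ℕ n) *ℕ (suc r *ℕ ⌈log₂ (r + 2) ⌉)} z≤n)

  solves-approx : 1 ℕ.≤ n → 0ℚ < ε → ε < 1ℚ → Solves constant (toTree (approx (steps ε)) output)
  solves-approx 1≤n 0<ε ε<1 = subst Good-run (sym (run-toTree I₁ I₂ (approx (steps ε)) output))
    (solved (Spec.holds (spec-approx M₁ M₂ 1≤K 1≤n (proj₁ (proj₂ (proj₁ max))) (proj₂ (proj₂ (proj₁ max))) (λ {X} → proj₂ max X))))
    where
    O = oracle I₁ I₂
    open Steps (steps-spec ε 0<ε ε<1)
    Good-run : Subset n × ℕ → Set
    Good-run (S , q) = CommonIndep I₁ I₂ S × ((1ℚ - ε) * ℕtoℚ r ≤ ℕtoℚ ∣ S ∣) ×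
      ((ℕtoℚ q * ℕtoℚ q) * (ε * ε) ≤ ℕtoℚ (constant *ℕ (n *ℕ n) *ℕ (suc r *ℕ ⌈log₂ (r + 2) ⌉)))
    solved : ∀ {S q} → (CommonIndep I₁ I₂ S × steps ε *ℕ r ℕ.≤ (2 + steps ε) *ℕ ∣ S ∣) ×
               (∃[ s ] (s *ℕ s ℕ.≤ 2 *ℕ r × q ℕ.≤ 60 *ℕ (n *ℕ (steps ε *ℕ suc s)))) → Good-run (S , q + 0)
    solved {S} {q} ((cS , near) , s , s² , q≤) = cS ,
      approximation ε a d ratio r (∣ S ∣) (size-bound (steps ε) a (suc d) r (∣ S ∣) 1≤K enough (proj₂ max S cS) near) ,
      query-bound ε a d ratio (q + 0) (constant *ℕ (n *ℕ n) *ℕ (suc r *ℕ ⌈log₂ (r + 2) ⌉))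
        (cost-bound queryFactor n (steps ε) a (suc d) r s (q + 0) (⌈log₂ (r + 2) ⌉) few s² q+0≤ (1≤⌈log₂⌉ r))
      where
      q+0≤ : q + 0 ℕ.≤ queryFactor *ℕ (n *ℕ (steps ε *ℕ suc s))
      q+0≤ = ℕₚ.≤-trans (ℕₚ.≤-reflexive (ℕₚ.+-identityʳ q)) (ℕₚ.≤-trans q≤ (ℕₚ.*-monoˡ-≤ (n *ℕ (steps ε *ℕ suc s)) 60≤queryFactor))

large-ε : ∀ {ε} r → 1ℚ ≤ ε → (1ℚ - ε) * ℕtoℚ r ≤ 0ℚ
large-ε {ε} r 1≤ε = ℚₚ.≤-trans (ℚₚ.*-monoʳ-≤-nonNeg (ℕtoℚ r) {{ℚ.nonNegative (ℕtoℚ-mono {0} {r} z≤n)}}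
    (ℚₚ.≤-trans (ℚₚ.+-monoˡ-≤ (ℚ.- ε) 1≤ε) (ℚₚ.≤-reflexive (ℚₚ.+-inverseʳ ε))))
  (ℚₚ.≤-reflexive (ℚₚ.*-zeroˡ (ℕtoℚ r)))

theorem1 : Σ ((n : ℕ) → ℚ → QueryTree n) λ alg →
    ∃[ C ] ∀ (n : ℕ) (I₁ I₂ : Oracle n) (r : ℕ) (ε : ℚ) →
    IsMatroid I₁ → IsMatroid I₂ → IsMaxCommonSize I₁ I₂ r → 0ℚ < ε →
    CommonIndep I₁ I₂ (proj₁ (run I₁ I₂ (alg n ε))) ×
    ((1ℚ - ε) * ℕtoℚ r ≤ ℕtoℚ ∣ proj₁ (run I₁ I₂ (alg n ε)) ∣) ×
    ((ℕtoℚ (proj₂ (run I₁ I₂ (alg n ε))) * ℕtoℚ (proj₂ (run I₁ I₂ (alg n ε)))) * (ε * ε)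
    ≤ ℕtoℚ (C *ℕ (n *ℕ n) *ℕ (suc r *ℕ ⌈log₂ (r + 2) ⌉)))
theorem1 = alg , constant , solves
  where
  solves : ∀ n (I₁ I₂ : Oracle n) r ε (M₁ : IsMatroid I₁) (M₂ : IsMatroid I₂) (max : IsMaxCommonSize I₁ I₂ r) →
           0ℚ < ε → Solves M₁ M₂ max ε constant (alg n ε)
  solves zero I₁ I₂ .0 ε M₁ M₂ max@(([] , _ , refl) , _) 0<ε =
    solves-⊥ M₁ M₂ max ε constant (ℚₚ.≤-reflexive (ℚₚ.*-zeroʳ (1ℚ - ε)))
  solves (suc n) I₁ I₂ r ε M₁ M₂ max 0<ε = if-elim (Solves M₁ M₂ max ε constant) (1ℚ ℚ.≤? ε)
    (λ 1≤ε → solves-⊥ M₁ M₂ max ε constant (large-ε r 1≤ε))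
    (λ 1≰ε → solves-approx M₁ M₂ max ε (s≤s z≤n) 0<ε (ℚₚ.≰⇒> 1≰ε))
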